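{- Let $n\ge 1$, $m\ge 2$, let $A_1,\dots,A_{m-1}$ be a system of mutually unbiased bases of $\mathbb{C}^n$, and assume that $A_1=I_n$, the identity matrix (i.e. $A_1$ is the standard basis of $\mathbb{C}^n$). Then the ideal $J_{1,m}^{\{n\}}\subseteq \mathbb{R}[x_{ij},y_{ij}:1\le i,j\le n]$ is a complete intersection prime ideal.
   Context: Two orthonormal bases $\{\mathbf{a}_1,\dots,\mathbf{a}_n\}$ and $\{\mathbf{b}_1,\dots,\mathbf{b}_n\}$ of $\mathbb{C}^n$ are mutually unbiased if $|\langle \mathbf{a}_i,\mathbf{b}_j\rangle|=\frac{1}{\sqrt n}$ for all $i,j$; a system of mutually unbiased bases (MUBs) is a list of pairwise mutually unbiased orthonormal bases. A basis is identified with the matrix whose columns are its vectors. Writing the $q$-th vector of $A_1$ as having entries $b_{iq}^{(1)}+i\,c_{iq}^{(1)}$ with real $b_{iq}^{(1)},c_{iq}^{(1)}$, the ideal $J_{1,m}^{\{n\}}$ of $\mathbb{R}[x_{ij},y_{ij}:1\le i,j\le n]$ is $$J_{1,m}^{\{n\}}=\Big(\Big\{\sum_{i=1}^{n}(x_{ij}b_{iq}^{(1)}+y_{ij}c_{iq}^{(1)})\Big\}^2+\Big\{\sum_{i=1}^{n}(b_{iq}^{(1)}y_{ij}-x_{ij}c_{iq}^{(1)})\Big\}^2-\frac1n\ :\ 1\le j,q\le n\Big),$$ which for $A_1=I_n$ is $(x_{ij}^2+y_{ij}^2-\frac1n:1\le i,j\le n)$. An ideal $I$ of a ring $R$ is a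 complete intersection if it is generated by an $R$-regular sequence, i.e. a sequence $x_1,\dots,x_r$ such that $x_i$ is a non-zero divisor in $R/(x_1,\dots,x_{i-1})$ for all $1\le i\le r$ and $R/(x_1,\dots,x_r)\ne 0$. -}

module Defs where

open import Algebra.Bundles using (CommutativeRing; RawRing)
open import Algebra.Core using (Op₁; Op₂)
import Algebra.Definitions.RawMonoid as RawMonoidDefs
import Algebra.Properties.AbelianGroup as AbelianGroupProperties
import Algebra.Properties.Ring as RingProperties
open import Data.Bool.Base using (if_then_else_)
open import Data.Fin.Base as Fin using (Fin; zero)
open import Data.Fin.Properties using (_≟_)
open import Data.Nat.Base as ℕ using (ℕ; _∸_; s≤s)
open import Data.Product.Base using (Σ-syntax; ∃-syntax; _×_; _,_; proj₁; proj₂)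
open import Data.Sum.Base using (_⊎_)
open import Data.Vec.Functional using (Vector)
open import Level using (Level; _⊔_; suc)
open import Relation.Binary.Core using (Rel)
open import Relation.Binary.Definitions using (_Respects_)
open import Relation.Binary.PropositionalEquality.Core using (_≢_)
open import Relation.Binary.Structures using (IsDecTotalOrder)
open import Relation.Nullary.Decidable using (⌊_⌋)
open import Relation.Unary using (Pred; _∈_; _∉_; _≐_)

private
  variable
    c ℓ ℓ₁ ℓ₂ p w : Level

-- Up to isomorphism ℝ is the only Dedekind-complete ordered field, and it
-- enters through that description.  The logic of the mathematics being
-- formalised is classical, so the order (hence also _≈_) is decidable and
-- _⁻¹ is a total operation, about which nothing is assumed at 0#.

record CompleteOrderedField c ℓ₁ ℓ₂ : Set (suc (c ⊔ ℓ₁ ⊔ ℓ₂)) where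
  infix  4 _≤_
  infix  9 _⁻¹
  field
    commutativeRing : CommutativeRing c ℓ₁
  open CommutativeRing commutativeRing public
  field
    _≤_             : Rel Carrier ℓ₂
    isDecTotalOrder : IsDecTotalOrder _≈_ _≤_
    0≉1             : 0# ≉ 1#
    _⁻¹             : Op₁ Carrier
    ⁻¹-inverseʳ     : ∀ {a} → a ≉ 0# → a * a ⁻¹ ≈ 1#
    +-monoˡ-≤       : ∀ d {a b} → a ≤ b → a + d ≤ b + d
    *-nonNeg        : ∀ {a b} → 0# ≤ a → 0# ≤ b → 0# ≤ a * b

  UpperBound : Pred Carrier p → Pred Carrier (c ⊔ ℓ₂ ⊔ p)
  UpperBound P u = ∀ {a} → a ∈ P → a ≤ u

  IsSupremum : Pred Carrier p → Pred Carrier (c ⊔ ℓ₂ ⊔ p)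
  IsSupremum P s = s ∈ UpperBound P × (∀ {u} → u ∈ UpperBound P → s ≤ u)

  field
    complete : (P : Pred Carrier (c ⊔ ℓ₁ ⊔ ℓ₂)) →
               (∃[ a ] a ∈ P) → (∃[ u ] u ∈ UpperBound P) → ∃[ s ] IsSupremum P s

module _ (R : CommutativeRing c ℓ) where
  open CommutativeRing R

  record Ideal p : Set (c ⊔ ℓ ⊔ suc p) where
    field
      ⟦_⟧      : Pred Carrier p
      respects : ⟦_⟧ Respects _≈_
      0-closed : 0# ∈ ⟦_⟧
      +-closed : ∀ {a b} → a ∈ ⟦_⟧ → b ∈ ⟦_⟧ → a + b ∈ ⟦_⟧
      *-closed : ∀ r {a} → a ∈ ⟦_⟧ → r * a ∈ ⟦_⟧

  open Ideal using (⟦_⟧)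

  data Generated (S : Pred Carrier p) : Pred Carrier (c ⊔ ℓ ⊔ p) where
    gen  : ∀ {a} → a ∈ S → Generated S a
    resp : ∀ {a b} → a ≈ b → Generated S a → Generated S b
    0∈   : Generated S 0#
    +∈   : ∀ {a b} → Generated S a → Generated S b → Generated S (a + b)
    *∈   : ∀ r {a} → Generated S a → Generated S (r * a)

  ⟨_⟩ : Pred Carrier p → Ideal (c ⊔ ℓ ⊔ p)
  ⟨ S ⟩ = record
    { ⟦_⟧ = Generated S
    ; respects = resp
    ; 0-closed = 0∈
    ; +-closed = +∈
    ; *-closed = *∈
    }

  NonZeroDivisor : Pred Carrier (c ⊔ ℓ)
  NonZeroDivisor a = ∀ b → a * b ≈ 0# → b ≈ 0#

  Nontrivial : Set ℓ
  Nontrivial = 1# ≉ 0#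

  IsPrime : Ideal p → Set (c ⊔ p)
  IsPrime I = 1# ∉ ⟦ I ⟧ × (∀ a b → a * b ∈ ⟦ I ⟧ → a ∈ ⟦ I ⟧ ⊎ b ∈ ⟦ I ⟧)

open Ideal public using (⟦_⟧)

-- R / I has the elements of R, compared modulo I.

_/_ : (R : CommutativeRing c ℓ) → Ideal R p → CommutativeRing c p
R / I = record
  { Carrier = Carrier
  ; _≈_ = _∼_
  ; _+_ = _+_
  ; _*_ = _*_
  ; -_ = -_
  ; 0# = 0#
  ; 1# = 1#
  ; isCommutativeRing = record
    { isRing = record
      { +-isAbelianGroup = record
        { isGroup = record
          { isMonoid = record
            { isSemigroup = record
              { isMagma = record
                { isEquivalence = record
                  { refl = ≈⇒∼ refl ; sym = ∼-sym ; trans = ∼-trans }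
                ; ∙-cong = +-cong∼
                }
              ; assoc = λ a b d → ≈⇒∼ (+-assoc a b d)
              }
            ; identity = (λ a → ≈⇒∼ (+-identityˡ a)) , (λ a → ≈⇒∼ (+-identityʳ a))
            }
          ; inverse = (λ a → ≈⇒∼ (-‿inverseˡ a)) , (λ a → ≈⇒∼ (-‿inverseʳ a))
          ; ⁻¹-cong = -‿cong∼
          }
        ; comm = λ a b → ≈⇒∼ (+-comm a b)
        }
      ; *-cong = *-cong∼
      ; *-assoc = λ a b d → ≈⇒∼ (*-assoc a b d)
      ; *-identity = (λ a → ≈⇒∼ (*-identityˡ a)) , (λ a → ≈⇒∼ (*-identityʳ a))
      ; distrib = (λ a b d → ≈⇒∼ (distribˡ a b d)) , (λ a b d → ≈⇒∼ (distribʳ a b d))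
      }
    ; *-comm = λ a b → ≈⇒∼ (*-comm a b)
    }
  }
  where
  open CommutativeRing R
  open Ideal I using (respects; 0-closed; +-closed; *-closed) renaming (⟦_⟧ to ⟪_⟫)
  open RingProperties ring using (-‿distribˡ-*; -‿distribʳ-*; -1*x≈-x)
  open AbelianGroupProperties +-abelianGroup using () renaming
    (⁻¹-∙-comm to -‿+-comm; ⁻¹-involutive to -‿involutive)
  open import Algebra.Properties.CommutativeSemigroup +-commutativeSemigroup using (interchange)
  open import Relation.Binary.Reasoning.Setoid setoid

  _∼_ : Rel Carrier _
  a ∼ b = a - b ∈ ⟪_⟫

  -∈ : ∀ {a} → a ∈ ⟪_⟫ → - a ∈ ⟪_⟫
  -∈ a∈ = respects (-1*x≈-x _) (*-closed (- 1#) a∈)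

  ≈⇒∼ : ∀ {a b} → a ≈ b → a ∼ b
  ≈⇒∼ {a} {b} a≈b = respects (sym (trans (+-congʳ a≈b) (-‿inverseʳ b))) 0-closed

  telescope : ∀ a b d → (a - b) + (b - d) ≈ a - d
  telescope a b d = begin
    (a - b) + (b - d)     ≈⟨ +-assoc a (- b) (b - d) ⟩
    a + (- b + (b - d))   ≈⟨ +-congˡ (+-assoc (- b) b (- d)) ⟨
    a + ((- b + b) - d)   ≈⟨ +-congˡ (+-congʳ (-‿inverseˡ b)) ⟩
    a + (0# - d)          ≈⟨ +-congˡ (+-identityˡ (- d)) ⟩
    a - d                 ∎

  ∼-sym : ∀ {a b} → a ∼ b → b ∼ a
  ∼-sym {a} {b} a∼b = respects eq (-∈ a∼b)
    where
    eq : - (a - b) ≈ b - a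
    eq = begin
      - (a - b)     ≈⟨ -‿+-comm a (- b) ⟨
      - a - - b     ≈⟨ +-congˡ (-‿involutive b) ⟩
      - a + b       ≈⟨ +-comm (- a) b ⟩
      b - a         ∎

  ∼-trans : ∀ {a b d} → a ∼ b → b ∼ d → a ∼ d
  ∼-trans {a} {b} {d} a∼b b∼d = respects (telescope a b d) (+-closed a∼b b∼d)

  +-cong∼ : ∀ {a a′ b b′} → a ∼ a′ → b ∼ b′ → (a + b) ∼ (a′ + b′)
  +-cong∼ {a} {a′} {b} {b′} a∼ b∼ =
    respects (trans (interchange a (- a′) b (- b′)) (+-congˡ (-‿+-comm a′ b′))) (+-closed a∼ b∼)

  -‿cong∼ : ∀ {a b} → a ∼ b → (- a) ∼ (- b)
  -‿cong∼ {a} {b} a∼b = respects (sym (-‿+-comm a (- b))) (-∈ a∼b)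

  *-cong∼ : ∀ {a a′ b b′} → a ∼ a′ → b ∼ b′ → (a * b) ∼ (a′ * b′)
  *-cong∼ {a} {a′} {b} {b′} a∼ b∼ = ∼-trans
    (respects eq₁ (*-closed a b∼)) (respects eq₂ (*-closed b′ a∼))
    where
    eq₁ : a * (b - b′) ≈ a * b - a * b′
    eq₁ = trans (distribˡ a b (- b′)) (+-congˡ (sym (-‿distribʳ-* a b′)))
    eq₂ : b′ * (a - a′) ≈ a * b′ - a′ * b′
    eq₂ = begin
      b′ * (a - a′)         ≈⟨ *-comm b′ (a - a′) ⟩
      (a - a′) * b′         ≈⟨ distribʳ b′ a (- a′) ⟩
      a * b′ + (- a′) * b′  ≈⟨ +-congˡ (-‿distribˡ-* a′ b′) ⟨
      a * b′ - a′ * b′      ∎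

module _ (R : CommutativeRing c ℓ) where
  open CommutativeRing R

  Entries : ∀ {r} → Vector Carrier r → Pred Carrier ℓ
  Entries xs a = ∃[ k ] a ≈ xs k

  EntriesBefore : ∀ {r} → Vector Carrier r → Fin r → Pred Carrier ℓ
  EntriesBefore xs i a = ∃[ k ] k Fin.< i × a ≈ xs k

  IsRegularSequence : ∀ {r} → Vector Carrier r → Set (c ⊔ ℓ)
  IsRegularSequence xs =
    (∀ i → NonZeroDivisor (R / ⟨_⟩ R (EntriesBefore xs i)) (xs i)) ×
    Nontrivial (R / ⟨_⟩ R (Entries xs))

  IsCompleteIntersection : Ideal R p → Set (c ⊔ ℓ ⊔ p)
  IsCompleteIntersection I =
    ∃[ r ] Σ[ xs ∈ Vector Carrier r ]
      IsRegularSequence xs × ⟦ I ⟧ ≐ ⟦ ⟨_⟩ R (Entries xs) ⟧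

-- R [ X ] is the commutative R-algebra freely generated by X: expressions
-- in the variables and constants, identified exactly when the axioms of
-- commutative rings and the arithmetic of the constants force it.

module PolynomialRing (R : CommutativeRing c ℓ) (X : Set w) where
  private module R = CommutativeRing R

  infix  8 :-_
  infixl 7 _:*_
  infixl 6 _:+_
  infix  4 _≋_

  data Polynomial : Set (c ⊔ w) where
    con       : R.Carrier → Polynomial
    var       : X → Polynomial
    _:+_ _:*_ : Op₂ Polynomial
    :-_       : Op₁ Polynomial

  data _≋_ : Rel Polynomial (c ⊔ ℓ ⊔ w) where
    refl        : ∀ {f} → f ≋ f
    sym         : ∀ {f g} → f ≋ g → g ≋ f
    trans       : ∀ {f g h} → f ≋ g → g ≋ h → f ≋ h
    con-cong    : ∀ {a b} → a R.≈ b → con a ≋ con b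
    con-+       : ∀ a b → con (a R.+ b) ≋ con a :+ con b
    con-*       : ∀ a b → con (a R.* b) ≋ con a :* con b
    +-cong      : ∀ {f f′ g g′} → f ≋ f′ → g ≋ g′ → f :+ g ≋ f′ :+ g′
    +-assoc     : ∀ f g h → (f :+ g) :+ h ≋ f :+ (g :+ h)
    +-comm      : ∀ f g → f :+ g ≋ g :+ f
    +-identityˡ : ∀ f → con R.0# :+ f ≋ f
    -‿cong      : ∀ {f g} → f ≋ g → :- f ≋ :- g
    -‿inverseˡ  : ∀ f → :- f :+ f ≋ con R.0#
    *-cong      : ∀ {f f′ g g′} → f ≋ f′ → g ≋ g′ → f :* g ≋ f′ :* g′
    *-assoc     : ∀ f g h → (f :* g) :* h ≋ f :* (g :* h)
    *-comm      : ∀ f g → f :* g ≋ g :* f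
    *-identityˡ : ∀ f → con R.1# :* f ≋ f
    distribˡ    : ∀ f g h → f :* (g :+ h) ≋ f :* g :+ f :* h

_[_] : CommutativeRing c ℓ → Set w → CommutativeRing (c ⊔ w) (c ⊔ ℓ ⊔ w)
R [ X ] = record
  { Carrier = Polynomial
  ; _≈_ = _≋_
  ; _+_ = _:+_
  ; _*_ = _:*_
  ; -_ = :-_
  ; 0# = con (CommutativeRing.0# R)
  ; 1# = con (CommutativeRing.1# R)
  ; isCommutativeRing = record
    { isRing = record
      { +-isAbelianGroup = record
        { isGroup = record
          { isMonoid = record
            { isSemigroup = record
              { isMagma = record
                { isEquivalence = record { refl = refl ; sym = sym ; trans = trans }
                ; ∙-cong = +-cong
                }
              ; assoc = +-assoc
              }
            ; identity = +-identityˡ , λ f → trans (+-comm f _) (+-identityˡ f)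
            }
          ; inverse = -‿inverseˡ , λ f → trans (+-comm f _) (-‿inverseˡ f)
          ; ⁻¹-cong = -‿cong
          }
        ; comm = +-comm
        }
      ; *-cong = *-cong
      ; *-assoc = *-assoc
      ; *-identity = *-identityˡ , λ f → trans (*-comm f _) (*-identityˡ f)
      ; distrib = distribˡ , λ f g h →
          trans (*-comm (g :+ h) f)
                (trans (distribˡ f g h) (+-cong (*-comm f g) (*-comm f h)))
      }
    ; *-comm = *-comm
    }
  }
  where open PolynomialRing R X

data Var (n : ℕ) : Set where
  xᵥ yᵥ : (i j : Fin n) → Var n

module _ (ℝ : CompleteOrderedField c ℓ₁ ℓ₂) where
  private
    module ℝ = CompleteOrderedField ℝ
    open ℝ using (_+_; _*_; -_; _-_; _⁻¹; _≤_; _≈_; 0#; 1#)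

  fromℕ : ℕ → ℝ.Carrier
  fromℕ n = RawMonoidDefs._×_ ℝ.+-rawMonoid n 1#

  ℂ : RawRing c ℓ₁
  ℂ = record
    { Carrier = ℝ.Carrier × ℝ.Carrier
    ; _≈_ = λ { (a , b) (a′ , b′) → a ≈ a′ × b ≈ b′ }
    ; _+_ = λ { (a , b) (a′ , b′) → a + a′ , b + b′ }
    ; _*_ = λ { (a , b) (a′ , b′) → a * a′ - b * b′ , a * b′ + b * a′ }
    ; -_ = λ { (a , b) → - a , - b }
    ; 0# = 0# , 0#
    ; 1# = 1# , 0#
    }

  private
    module ℂ = RawRing ℂ
    open RawMonoidDefs ℂ.+-rawMonoid using () renaming (sum to ∑)

  re im : ℂ.Carrier → ℝ.Carrier
  re = proj₁
  im = proj₂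

  conj : Op₁ ℂ.Carrier
  conj z = re z , - im z

  -- s = √a, which a complete ordered field contains for every a ≥ 0
  IsSqrt : ℝ.Carrier → ℝ.Carrier → Set (ℓ₁ ⊔ ℓ₂)
  IsSqrt a s = 0# ≤ s × s * s ≈ a

  IsModulus : ℂ.Carrier → ℝ.Carrier → Set (ℓ₁ ⊔ ℓ₂)
  IsModulus z r = IsSqrt (re z * re z + im z * im z) r

  -- The first index is the row and the second the column, so the basis
  -- given by A consists of the vectors λ i → A i q.

  Matrix : ℕ → Set c
  Matrix n = Fin n → Fin n → ℂ.Carrier

  Iₙ : ∀ {n} → Matrix n
  Iₙ i q = if ⌊ i ≟ q ⌋ then ℂ.1# else ℂ.0#

  _≈ᴹ_ : ∀ {n} → Rel (Matrix n) ℓ₁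
  A ≈ᴹ B = ∀ i q → A i q ℂ.≈ B i q

  column : ∀ {n} → Matrix n → Fin n → Vector ℂ.Carrier n
  column A q i = A i q

  inner : ∀ {n} → Vector ℂ.Carrier n → Vector ℂ.Carrier n → ℂ.Carrier
  inner v w = ∑ λ i → conj (v i) ℂ.* w i

  combination : ∀ {n} → Vector ℂ.Carrier n → Matrix n → Vector ℂ.Carrier n
  combination z A i = ∑ λ q → z q ℂ.* A i q

  record IsOrthonormalBasis {n} (A : Matrix n) : Set (c ⊔ ℓ₁) where
    field
      independent : ∀ z → (∀ i → combination z A i ℂ.≈ ℂ.0#) → ∀ q → z q ℂ.≈ ℂ.0#
      spanning    : ∀ (v : Vector ℂ.Carrier n) → ∃[ z ] ∀ i → combination z A i ℂ.≈ v i
      orthonormal : ∀ q r → inner (column A q) (column A r) ℂ.≈ Iₙ q r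

  MutuallyUnbiased : ∀ {n} → Matrix n → Matrix n → Set (c ⊔ ℓ₁ ⊔ ℓ₂)
  MutuallyUnbiased {n} A B =
    ∃[ √n ] IsSqrt (fromℕ n) √n ×
            (∀ i j → IsModulus (inner (column A i) (column B j)) (√n ⁻¹))

  record IsMUBSystem {n k} (A : Fin k → Matrix n) : Set (c ⊔ ℓ₁ ⊔ ℓ₂) where
    field
      isOrthonormalBasis : ∀ s → IsOrthonormalBasis (A s)
      mutuallyUnbiased   : ∀ s t → s ≢ t → MutuallyUnbiased (A s) (A t)

  ℝ[x,y] : ℕ → CommutativeRing c (c ⊔ ℓ₁)
  ℝ[x,y] n = ℝ.commutativeRing [ Var n ]

  module _ {n : ℕ} (A : Matrix n) where
    private
      module P = CommutativeRing (ℝ[x,y] n)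
      open PolynomialRing ℝ.commutativeRing (Var n) using (con; var)
      open RawMonoidDefs P.+-rawMonoid using (sum)

      x y b c′ : Fin n → Fin n → P.Carrier
      x i j = var (xᵥ i j)
      y i j = var (yᵥ i j)
      b i q = con (re (A i q))
      c′ i q = con (im (A i q))

    generator : Fin n → Fin n → P.Carrier
    generator j q =
      (u P.* u P.+ v P.* v) P.- con (fromℕ n ⁻¹)
      where
      u v : P.Carrier
      u = sum λ i → x i j P.* b i q P.+ y i j P.* c′ i q
      v = sum λ i → b i q P.* y i j P.- x i j P.* c′ i q

    J : Ideal (ℝ[x,y] n) (c ⊔ ℓ₁)
    J = ⟨_⟩ (ℝ[x,y] n) λ f → ∃[ j ] ∃[ q ] f P.≈ generator j q

first : ∀ {m} → 2 ℕ.≤ m → Fin (m ∸ 1)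
first (s≤s (s≤s _)) = zero

-- Since A₁ is the identity, the generators are the circles x² + y² = 1/n, one
-- for each pair of indices, and 1/n has a square root s ≠ 0 by completeness.
-- Let I be generated by the circles of some of the pairs.  Parametrise those
-- circles rationally, by (s(1-t²)/(1+t²), 2st/(1+t²)), and leave the other
-- pairs free.  Every polynomial either lies in I or is nonzero at a parameter
-- point: adjoin the variables one pair at a time, writing f = a + b y modulo
-- x² + y² = 1/n with a, b polynomials in x, and use that (x , y) and (x , -y)
-- are both on the circle.  If f and g are nonzero at points P and Q, then on the
-- line joining P to Q they are rational functions of one variable, neither
-- identically zero, so f g is nonzero somewhere and is not in I.  Hence I is
-- prime.  The equation of the circle of a free pair does not hold at the origin,
-- so it is not in I and is therefore not a zero divisor modulo I.

module Submission where

open import Algebra.Bundles using (CommutativeRing; RawRing)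
import Algebra.Construct.Pointwise as Pointwise
open import Algebra.Morphism.Structures using (IsRingHomomorphism)
import Algebra.Properties.CommutativeMonoid.Sum as Sum
import Algebra.Properties.Group as GroupProperties
import Algebra.Properties.Ring as RingProperties
open import Data.Bool.Base using (Bool; true; false)
open import Data.Fin.Base as Fin using (Fin; combine; remQuot)
import Data.Fin.Properties as Fin
open import Data.List.Base using (List; []; _∷_; allFin; cartesianProduct)
import Data.List.Membership.Propositional as List
open import Data.List.Membership.Propositional.Properties using (∈-allFin; ∈-cartesianProduct⁺)
open import Data.List.Relation.Unary.All as All using (All)
open import Data.List.Relation.Unary.AllPairs using ([]; _∷_)
open import Data.List.Relation.Unary.Any using (here; there)
open import Data.List.Relation.Unary.Unique.Propositional using (Unique)
open import Data.List.Relation.Unary.Unique.Propositional.Properties using (allFin⁺; cartesianProduct⁺)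
open import Data.Maybe.Base using (Maybe; just; nothing)
open import Data.Nat.Base as ℕ using (ℕ; zero; suc)
import Data.Nat.Properties as ℕ
open import Data.Product.Base using (_×_; _,_; ∃-syntax; proj₁; proj₂)
open import Data.Product.Properties using (≡-dec)
open import Data.Sum.Base using (_⊎_; inj₁; inj₂; [_,_]′)
open import Data.Vec.Functional using (Vector)
open import Function.Base using (id; const; _∘_; flip)
open import Level as Level using (_⊔_; 0ℓ; Lift; lift; lower)
open import Relation.Binary.Definitions using (_Respects_)
open import Relation.Binary.PropositionalEquality as ≡ using (_≡_; _≢_)
open import Relation.Binary.Structures using (IsDecTotalOrder)
open import Relation.Nullary.Decidable using (yes; no; isYes)
open import Relation.Nullary.Negation using (¬_; contradiction)
open import Relation.Unary using (Pred; _∈_; _∉_; _⊆_; _≐_)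
open import Defs

-- The quotient by one circle is a domain, but that alone does not settle several circles: a tensor
-- product of domains over the reals need not be a domain, as two copies of the complex numbers
-- show. What helps is that an affine space maps to the product of circles by rational functions
-- with real coefficients. The denominators `1 + t²` have no real zero, so evaluation is total along
-- every line. The one point that each circle loses, `(-s , 0)`, does no harm: infinitely many
-- abscissas remain, each attained with both signs of `y`.
--
-- Polynomials are expressions up to derivable equations, with no normal form to compare. Vanishing
-- modulo the ideal is therefore not read off from canonical coefficients: each stage of the
-- induction returns either a derivation that the element is zero or a point where it is not. The
-- representations used on the way are not claimed to be unique, so they make sense inside a
-- quotient ring.

-- Ring identities with integer coefficients

module IntegerSolver {c ℓ} (R : CommutativeRing c ℓ) where
  open CommutativeRing R
  open import Algebra.Solver.Ring.AlmostCommutativeRing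
  open import Algebra.Properties.Ring ring using (-‿distribˡ-*; -‿distribʳ-*; -0#≈0#)
  open import Algebra.Properties.AbelianGroup +-abelianGroup using (⁻¹-∙-comm; ⁻¹-involutive)
  open import Algebra.Properties.CommutativeSemigroup +-commutativeSemigroup using (interchange)
  open import Algebra.Properties.Semiring.Mult.TCOptimised semiring renaming (_×_ to _·_) using (×-homo-+; ×1-homo-*)
  open import Relation.Binary.Reasoning.Setoid setoid

  -- Coefficients are kept reduced, so that equal ones are identical and solved
  -- equations hold by refl.
  reduce : ℕ → ℕ → ℕ × ℕ
  reduce (suc a) (suc b) = reduce a b
  reduce a b = a , b

  -- The pair (m , n) stands for the integer m - n.
  differences : RawRing 0ℓ 0ℓ
  differences = record
    { Carrier = ℕ × ℕ
    ; _≈_ = ≡._≡_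
    ; _+_ = λ { (a , b) (d , e) → reduce (a ℕ.+ d) (b ℕ.+ e) }
    ; _*_ = λ { (a , b) (d , e) → reduce (a ℕ.* d ℕ.+ b ℕ.* e) (a ℕ.* e ℕ.+ b ℕ.* d) }
    ; -_ = λ { (a , b) → b , a }
    ; 0# = 0 , 0
    ; 1# = 1 , 0
    }

  -- The split makes numerals compute to sums of 1#.
  ⟦_⟧ᵈ : ℕ × ℕ → Carrier
  ⟦ a , zero ⟧ᵈ = a · 1#
  ⟦ a , b@(suc _) ⟧ᵈ = a · 1# - b · 1#

  ⟦⟧ᵈ-minus : ∀ a b → ⟦ a , b ⟧ᵈ ≈ a · 1# - b · 1#
  ⟦⟧ᵈ-minus a zero = sym (trans (+-congˡ -0#≈0#) (+-identityʳ _))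
  ⟦⟧ᵈ-minus a (suc b) = refl

  minus-+ : ∀ a b d e → (a + d) - (b + e) ≈ (a - b) + (d - e)
  minus-+ a b d e = trans (+-congˡ (sym (⁻¹-∙-comm b e))) (interchange a d (- b) (- e))

  minus-swap : ∀ a b → b - a ≈ - (a - b)
  minus-swap a b = trans (+-comm b (- a)) (trans (+-congˡ (sym (⁻¹-involutive b))) (⁻¹-∙-comm a (- b)))

  minus-* : ∀ a b d e → (a * d + b * e) - (a * e + b * d) ≈ (a - b) * (d - e)
  minus-* a b d e = begin
    (a * d + b * e) - (a * e + b * d)         ≈⟨ minus-+ _ _ _ _ ⟩
    (a * d - a * e) + (b * e - b * d)         ≈⟨ +-cong (factor a d e) (factor b e d) ⟩
    a * (d - e) + b * (e - d)                 ≈⟨ +-congˡ (*-congˡ (minus-swap d e)) ⟩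
    a * (d - e) + b * - (d - e)               ≈⟨ +-congˡ (-‿distribʳ-* b _) ⟨
    a * (d - e) + - (b * (d - e))             ≈⟨ +-congˡ (-‿distribˡ-* b _) ⟩
    a * (d - e) + - b * (d - e)               ≈⟨ distribʳ _ a (- b) ⟨
    (a - b) * (d - e)                         ∎
    where
    factor : ∀ x y z → x * y - x * z ≈ x * (y - z)
    factor x y z = trans (+-congˡ (-‿distribʳ-* x z)) (sym (distribˡ x y (- z)))

  minus-cancel : ∀ a b d e → a + e ≈ d + b → a - b ≈ d - e
  minus-cancel a b d e eq = begin
    a - b                  ≈⟨ +-identityʳ _ ⟨
    (a - b) + 0#           ≈⟨ +-congˡ (-‿inverseʳ e) ⟨
    (a - b) + (e - e)      ≈⟨ minus-+ a b e e ⟨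
    (a + e) - (b + e)      ≈⟨ +-cong eq (-‿cong (+-comm b e)) ⟩
    (d + b) - (e + b)      ≈⟨ minus-+ d e b b ⟩
    (d - e) + (b - b)      ≈⟨ +-congˡ (-‿inverseʳ b) ⟩
    (d - e) + 0#           ≈⟨ +-identityʳ _ ⟩
    d - e                  ∎

  reduced : ℕ → ℕ → Carrier
  reduced a b = ⟦ reduce a b ⟧ᵈ

  reduce-minus : ∀ a b → reduced a b ≈ a · 1# - b · 1#
  reduce-minus zero b = ⟦⟧ᵈ-minus 0 b
  reduce-minus (suc a) zero = ⟦⟧ᵈ-minus (suc a) 0
  reduce-minus (suc a) (suc b) = begin
    reduced a b                        ≈⟨ reduce-minus a b ⟩
    a · 1# - b · 1#                    ≈⟨ +-identityˡ _ ⟨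
    0# + (a · 1# - b · 1#)             ≈⟨ +-congʳ (-‿inverseʳ 1#) ⟨
    (1# - 1#) + (a · 1# - b · 1#)      ≈⟨ minus-+ _ _ _ _ ⟨
    (1# + a · 1#) - (1# + b · 1#)      ≈⟨ +-cong (×-homo-+ 1# 1 a) (-‿cong (×-homo-+ 1# 1 b)) ⟨
    suc a · 1# - suc b · 1#            ∎

  morphism : differences -Raw-AlmostCommutative⟶ fromCommutativeRing R
  morphism = record
    { ⟦_⟧ = ⟦_⟧ᵈ
    ; +-homo = λ { (a , b) (d , e) → begin
        reduced (a ℕ.+ d) (b ℕ.+ e)                 ≈⟨ reduce-minus (a ℕ.+ d) (b ℕ.+ e) ⟩
        (a ℕ.+ d) · 1# - (b ℕ.+ e) · 1#            ≈⟨ +-cong (×-homo-+ 1# a d) (-‿cong (×-homo-+ 1# b e)) ⟩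
        (a · 1# + d · 1#) - (b · 1# + e · 1#)      ≈⟨ minus-+ _ _ _ _ ⟩
        (a · 1# - b · 1#) + (d · 1# - e · 1#)      ≈⟨ +-cong (⟦⟧ᵈ-minus a b) (⟦⟧ᵈ-minus d e) ⟨
        ⟦ a , b ⟧ᵈ + ⟦ d , e ⟧ᵈ                    ∎ }
    ; *-homo = λ { (a , b) (d , e) → begin
        reduced (a ℕ.* d ℕ.+ b ℕ.* e) (a ℕ.* e ℕ.+ b ℕ.* d)
          ≈⟨ reduce-minus (a ℕ.* d ℕ.+ b ℕ.* e) (a ℕ.* e ℕ.+ b ℕ.* d) ⟩
        (a ℕ.* d ℕ.+ b ℕ.* e) · 1# - (a ℕ.* e ℕ.+ b ℕ.* d) · 1#
          ≈⟨ +-cong (sum-of-products a d b e) (-‿cong (sum-of-products a e b d)) ⟩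
        (a · 1# * (d · 1#) + b · 1# * (e · 1#)) - (a · 1# * (e · 1#) + b · 1# * (d · 1#))
          ≈⟨ minus-* _ _ _ _ ⟩
        (a · 1# - b · 1#) * (d · 1# - e · 1#)
          ≈⟨ *-cong (⟦⟧ᵈ-minus a b) (⟦⟧ᵈ-minus d e) ⟨
        ⟦ a , b ⟧ᵈ * ⟦ d , e ⟧ᵈ ∎ }
    ; -‿homo = λ { (a , b) → begin
        ⟦ b , a ⟧ᵈ              ≈⟨ ⟦⟧ᵈ-minus b a ⟩
        b · 1# - a · 1#         ≈⟨ minus-swap _ _ ⟩
        - (a · 1# - b · 1#)     ≈⟨ -‿cong (⟦⟧ᵈ-minus a b) ⟨
        - ⟦ a , b ⟧ᵈ            ∎ }
    ; 0-homo = refl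
    ; 1-homo = refl
    }
    where
    sum-of-products : ∀ i j k l → (i ℕ.* j ℕ.+ k ℕ.* l) · 1# ≈ i · 1# * (j · 1#) + k · 1# * (l · 1#)
    sum-of-products i j k l = trans (×-homo-+ 1# (i ℕ.* j) (k ℕ.* l)) (+-cong (×1-homo-* i j) (×1-homo-* k l))

  coefficients-agree? : ∀ x y → Maybe (⟦ x ⟧ᵈ ≈ ⟦ y ⟧ᵈ)
  coefficients-agree? (a , b) (d , e) with a ℕ.+ e ℕ.≟ d ℕ.+ b
  ... | no _ = nothing
  ... | yes eq = just (begin
    ⟦ a , b ⟧ᵈ           ≈⟨ ⟦⟧ᵈ-minus a b ⟩
    a · 1# - b · 1#      ≈⟨ minus-cancel _ _ _ _ (trans (sym (×-homo-+ 1# a e))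
                              (trans (reflexive (≡.cong (_· 1#) eq)) (×-homo-+ 1# d b))) ⟩
    d · 1# - e · 1#      ≈⟨ ⟦⟧ᵈ-minus d e ⟨
    ⟦ d , e ⟧ᵈ           ∎)

  open import Algebra.Solver.Ring differences (fromCommutativeRing R) morphism coefficients-agree? public
    using (solve; _:=_; _:+_; _:*_; _:-_; :-_; Polynomial; con)

  numeral : ∀ {n} → ℕ → Polynomial n
  numeral k = con (k , 0)

-- Inequalities in the ordered field and existence of square roots

module OrderedField {c ℓ₁ ℓ₂} (ℝ : CompleteOrderedField c ℓ₁ ℓ₂) where
  open CompleteOrderedField ℝ
  open IsDecTotalOrder isDecTotalOrder using (_≟_; total; antisym; ≤-respʳ-≈; ≤-respˡ-≈)
    renaming (trans to ≤-trans; refl to ≤-refl; reflexive to ≤-reflexive)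
  open IntegerSolver commutativeRing
  open import Relation.Binary.Reasoning.Setoid setoid

  zero-product : ∀ {a b} → a * b ≈ 0# → a ≈ 0# ⊎ b ≈ 0#
  zero-product {a} {b} ab≈0 with a ≟ 0#
  ... | yes a≈0 = inj₁ a≈0
  ... | no a≉0 = inj₂ (begin
    b                  ≈⟨ *-identityˡ b ⟨
    1# * b             ≈⟨ *-congʳ (⁻¹-inverseʳ a≉0) ⟨
    a * a ⁻¹ * b       ≈⟨ solve 3 (λ a i b → a :* i :* b := i :* (a :* b)) refl a (a ⁻¹) b ⟩
    a ⁻¹ * (a * b)     ≈⟨ *-congˡ ab≈0 ⟩
    a ⁻¹ * 0#          ≈⟨ zeroʳ _ ⟩
    0#                 ∎)

  *-≉0 : ∀ {a b} → a ≉ 0# → b ≉ 0# → a * b ≉ 0#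
  *-≉0 a≉0 b≉0 ab≈0 with zero-product ab≈0
  ... | inj₁ a≈0 = a≉0 a≈0
  ... | inj₂ b≈0 = b≉0 b≈0

  minus≈0⇒≈ : ∀ {a b} → a - b ≈ 0# → a ≈ b
  minus≈0⇒≈ {a} {b} eq = begin
    a              ≈⟨ solve 2 (λ a b → a := (a :- b) :+ b) refl a b ⟩
    (a - b) + b    ≈⟨ +-congʳ eq ⟩
    0# + b         ≈⟨ +-identityˡ b ⟩
    b              ∎

  ≤⇒0≤minus : ∀ {a b} → a ≤ b → 0# ≤ b - a
  ≤⇒0≤minus {a} a≤b = ≤-respˡ-≈ (-‿inverseʳ a) (+-monoˡ-≤ (- a) a≤b)

  0≤minus⇒≤ : ∀ {a b} → 0# ≤ b - a → a ≤ b
  0≤minus⇒≤ {a} {b} 0≤b-a = ≤-respˡ-≈ (+-identityˡ a)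
    (≤-respʳ-≈ (solve 2 (λ a b → (b :- a) :+ a := b) refl a b) (+-monoˡ-≤ a 0≤b-a))

  +-nonNeg : ∀ {a b} → 0# ≤ a → 0# ≤ b → 0# ≤ a + b
  +-nonNeg {a} {b} 0≤a 0≤b = ≤-trans 0≤b (≤-respˡ-≈ (+-identityˡ b) (+-monoˡ-≤ b 0≤a))

  square-nonNeg : ∀ a → 0# ≤ a * a
  square-nonNeg a with total 0# a
  ... | inj₁ 0≤a = *-nonNeg 0≤a 0≤a
  ... | inj₂ a≤0 = ≤-respʳ-≈ (solve 1 (λ a → (numeral 0 :- a) :* (numeral 0 :- a) := a :* a) refl a)
    (*-nonNeg (≤⇒0≤minus a≤0) (≤⇒0≤minus a≤0))

  0≤1 : 0# ≤ 1#
  0≤1 = ≤-respʳ-≈ (*-identityˡ 1#) (square-nonNeg 1#)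

  1+nonNeg≉0 : ∀ {a} → 0# ≤ a → 1# + a ≉ 0#
  1+nonNeg≉0 {a} 0≤a 1+a≈0 = 0≉1 (antisym 0≤1 (0≤minus⇒≤ (≤-respʳ-≈ (begin
    a                 ≈⟨ solve 1 (λ a → a := (numeral 1 :+ a) :- numeral 1) refl a ⟩
    (1# + a) - 1#     ≈⟨ +-congʳ 1+a≈0 ⟩
    0# - 1#           ∎) 0≤a)))

  +-≉0 : ∀ {a b} → 0# ≤ a → a ≉ 0# → 0# ≤ b → a + b ≉ 0#
  +-≉0 {a} {b} 0≤a a≉0 0≤b a+b≈0 = a≉0 (antisym (≤-respʳ-≈ a+b≈0 a≤a+b) 0≤a)
    where
    a≤a+b : a ≤ a + b
    a≤a+b = 0≤minus⇒≤ (≤-respʳ-≈ (solve 2 (λ a b → b := (a :+ b) :- a) refl a b) 0≤b)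

  ⁻¹-nonNeg : ∀ {a} → 0# ≤ a → a ≉ 0# → 0# ≤ a ⁻¹
  ⁻¹-nonNeg {a} 0≤a a≉0 = ≤-respʳ-≈ (begin
    a * (a ⁻¹ * a ⁻¹)     ≈⟨ *-assoc _ _ _ ⟨
    a * a ⁻¹ * a ⁻¹       ≈⟨ *-congʳ (⁻¹-inverseʳ a≉0) ⟩
    1# * a ⁻¹             ≈⟨ *-identityˡ _ ⟩
    a ⁻¹                  ∎) (*-nonNeg 0≤a (square-nonNeg (a ⁻¹)))

  ⁻¹-≉0 : ∀ {a} → a ≉ 0# → a ⁻¹ ≉ 0#
  ⁻¹-≉0 {a} a≉0 i≈0 = 0≉1 (begin
    0#         ≈⟨ zeroʳ a ⟨
    a * 0#     ≈⟨ *-congˡ i≈0 ⟨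
    a * a ⁻¹   ≈⟨ ⁻¹-inverseʳ a≉0 ⟩
    1#         ∎)

  cancel-nonNeg : ∀ {a b} → 0# ≤ a → a ≉ 0# → 0# ≤ a * b → 0# ≤ b
  cancel-nonNeg {a} {b} 0≤a a≉0 0≤ab = ≤-respʳ-≈ (begin
    a ⁻¹ * (a * b)    ≈⟨ solve 3 (λ a i b → i :* (a :* b) := (a :* i) :* b) refl a (a ⁻¹) b ⟩
    a * a ⁻¹ * b      ≈⟨ *-congʳ (⁻¹-inverseʳ a≉0) ⟩
    1# * b            ≈⟨ *-identityˡ b ⟩
    b                 ∎) (*-nonNeg (⁻¹-nonNeg 0≤a a≉0) 0≤ab)

  -- If `b` is below `a` and different from it, dividing `b² - a² = (a - b)(-(a + b))` by `a - b`
  -- gives `a + b ≤ 0`, and `2b ≥ 0` turns this into `a ≤ b`.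
  square-≤⇒≤ : ∀ {a b} → 0# ≤ b → a * a ≤ b * b → a ≤ b
  square-≤⇒≤ {a} {b} 0≤b aa≤bb with total a b
  ... | inj₁ a≤b = a≤b
  ... | inj₂ b≤a with a - b ≟ 0#
  ...   | yes a-b≈0 = ≤-reflexive (minus≈0⇒≈ a-b≈0)
  ...   | no a-b≉0 = 0≤minus⇒≤ (≤-respʳ-≈ lemma (+-nonNeg 0≤-[a+b] (+-nonNeg 0≤b 0≤b)))
    where
    0≤-[a+b] : 0# ≤ - (a + b)
    0≤-[a+b] = cancel-nonNeg (≤⇒0≤minus b≤a) a-b≉0 (≤-respʳ-≈
      (solve 2 (λ a b → b :* b :- a :* a := (a :- b) :* (:- (a :+ b))) refl a b) (≤⇒0≤minus aa≤bb))
    lemma : - (a + b) + (b + b) ≈ b - a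
    lemma = solve 2 (λ a b → :- (a :+ b) :+ (b :+ b) := b :- a) refl a b

  -- One step of Heron's iteration from w > 0 overshoots the root of r, and
  -- r divided by it undershoots; the supremum of {a : a² ≤ r} lies between
  -- the two for every w, in particular for w the supremum itself.
  module Heron {r} (0≤r : 0# ≤ r) (r≉0 : r ≉ 0#) {w} (0≤w : 0# ≤ w) (w≉0 : w ≉ 0#) where
    q = w * w + r

    0≤q : 0# ≤ q
    0≤q = +-nonNeg (square-nonNeg w) 0≤r

    q≉0 : q ≉ 0#
    q≉0 = +-≉0 (square-nonNeg w) (*-≉0 w≉0 w≉0) 0≤r

    0≤2w : 0# ≤ w + w
    0≤2w = +-nonNeg 0≤w 0≤w

    2w≉0 : w + w ≉ 0#
    2w≉0 = +-≉0 0≤w w≉0 0≤w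

    -- The harmonic and the arithmetic mean of `w` and `r / w`; their product is `r`.
    lower-bound upper-bound : Carrier
    lower-bound = (w + w) * r * q ⁻¹
    upper-bound = q * (w + w) ⁻¹

    0≤upper : 0# ≤ upper-bound
    0≤upper = *-nonNeg 0≤q (⁻¹-nonNeg 0≤2w 2w≉0)

    0≤lower : 0# ≤ lower-bound
    0≤lower = *-nonNeg (*-nonNeg 0≤2w 0≤r) (⁻¹-nonNeg 0≤q q≉0)

    lower≉0 : lower-bound ≉ 0#
    lower≉0 = *-≉0 (*-≉0 2w≉0 r≉0) (⁻¹-≉0 q≉0)

    q*lower : q * lower-bound ≈ (w + w) * r
    q*lower = begin
      q * ((w + w) * r * q ⁻¹)     ≈⟨ solve 3 (λ q x i → q :* (x :* i) := q :* i :* x) refl q ((w + w) * r) (q ⁻¹) ⟩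
      q * q ⁻¹ * ((w + w) * r)     ≈⟨ *-congʳ (⁻¹-inverseʳ q≉0) ⟩
      1# * ((w + w) * r)           ≈⟨ *-identityˡ _ ⟩
      (w + w) * r                  ∎

    2w*upper : (w + w) * upper-bound ≈ q
    2w*upper = begin
      (w + w) * (q * (w + w) ⁻¹)   ≈⟨ solve 3 (λ v q i → v :* (q :* i) := v :* i :* q) refl (w + w) q ((w + w) ⁻¹) ⟩
      (w + w) * (w + w) ⁻¹ * q     ≈⟨ *-congʳ (⁻¹-inverseʳ 2w≉0) ⟩
      1# * q                       ≈⟨ *-identityˡ q ⟩
      q                            ∎

    -- Clearing the denominator `q²` turns the gap into `r (w² - r)²`. Up to the factor `r`, the
    -- same square is the gap for the upper bound.
    lower²≤r : lower-bound * lower-bound ≤ r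
    lower²≤r = 0≤minus⇒≤ (cancel-nonNeg (square-nonNeg q) (*-≉0 q≉0 q≉0) (≤-respʳ-≈ (sym eq)
      (*-nonNeg 0≤r (square-nonNeg (w * w - r)))))
      where
      l = lower-bound
      eq : q * q * (r - l * l) ≈ r * ((w * w - r) * (w * w - r))
      eq = begin
        q * q * (r - l * l)
          ≈⟨ solve 3 (λ q r l → q :* q :* (r :- l :* l) := r :* (q :* q) :- q :* l :* (q :* l)) refl q r l ⟩
        r * (q * q) - q * l * (q * l)
          ≈⟨ +-congˡ (-‿cong (*-cong q*lower q*lower)) ⟩
        r * (q * q) - (w + w) * r * ((w + w) * r)
          ≈⟨ solve 2 (λ w r → r :* ((w :* w :+ r) :* (w :* w :+ r)) :- (w :+ w) :* r :* ((w :+ w) :* r)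
                               := r :* ((w :* w :- r) :* (w :* w :- r))) refl w r ⟩
        r * ((w * w - r) * (w * w - r)) ∎

    r≤upper² : r ≤ upper-bound * upper-bound
    r≤upper² = 0≤minus⇒≤ (cancel-nonNeg (square-nonNeg (w + w)) (*-≉0 2w≉0 2w≉0) (≤-respʳ-≈ (sym eq)
      (square-nonNeg (w * w - r))))
      where
      u = upper-bound
      eq : (w + w) * (w + w) * (u * u - r) ≈ (w * w - r) * (w * w - r)
      eq = begin
        (w + w) * (w + w) * (u * u - r)
          ≈⟨ solve 3 (λ v u r → v :* v :* (u :* u :- r) := v :* u :* (v :* u) :- v :* v :* r) refl (w + w) u r ⟩
        (w + w) * u * ((w + w) * u) - (w + w) * (w + w) * r
          ≈⟨ +-congʳ (*-cong 2w*upper 2w*upper) ⟩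
        q * q - (w + w) * (w + w) * r
          ≈⟨ solve 2 (λ w r → (w :* w :+ r) :* (w :* w :+ r) :- (w :+ w) :* (w :+ w) :* r
                              := (w :* w :- r) :* (w :* w :- r)) refl w r ⟩
        (w * w - r) * (w * w - r) ∎

    -- Both means lie between `w` and `r / w`, so `w` stays below the arithmetic one only if
    -- `w² ≤ r`, and above the harmonic one only if `r ≤ w²`.
    bounds-sqrt : lower-bound ≤ w → w ≤ upper-bound → w * w ≈ r
    bounds-sqrt l≤w w≤u = antisym (0≤minus⇒≤ w²≤r) (0≤minus⇒≤ r≤w²)
      where
      w²≤r : 0# ≤ r - w * w
      w²≤r = ≤-respʳ-≈ (begin
        (w + w) * (upper-bound - w)               ≈⟨ solve 2 (λ w u → (w :+ w) :* (u :- w) := (w :+ w) :* u :- (w :+ w) :* w) refl w upper-bound ⟩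
        (w + w) * upper-bound - (w + w) * w       ≈⟨ +-congʳ 2w*upper ⟩
        q - (w + w) * w                           ≈⟨ solve 2 (λ w r → w :* w :+ r :- (w :+ w) :* w := r :- w :* w) refl w r ⟩
        r - w * w                                 ∎) (*-nonNeg 0≤2w (≤⇒0≤minus w≤u))
      r≤w² : 0# ≤ w * w - r
      r≤w² = cancel-nonNeg 0≤w w≉0 (≤-respʳ-≈ (begin
        q * (w - lower-bound)            ≈⟨ solve 3 (λ q w l → q :* (w :- l) := q :* w :- q :* l) refl q w lower-bound ⟩
        q * w - q * lower-bound          ≈⟨ +-congˡ (-‿cong q*lower) ⟩
        q * w - (w + w) * r              ≈⟨ solve 2 (λ w r → (w :* w :+ r) :* w :- (w :+ w) :* r := w :* (w :* w :- r)) refl w r ⟩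
        w * (w * w - r)                  ∎) (*-nonNeg 0≤q (≤⇒0≤minus l≤w)))

  sqrt-exists : ∀ {r} → 0# ≤ r → r ≉ 0# → ∃[ s ] s * s ≈ r
  sqrt-exists {r} 0≤r r≉0 = s , Sup.bounds-sqrt (ub (lift Sup.lower²≤r)) (least (λ a∈ → bound 0≤s s≉0 (lower a∈)))
    where
    -- The guess `w = 1` gives a member and a bound of the set before `s` is available. Its lower
    -- bound is positive and forces `s ≠ 0`, as the second guess `w = s` requires.
    module Start = Heron 0≤r r≉0 0≤1 (λ 1≈0 → 0≉1 (sym 1≈0))
    bound : ∀ {w} (0≤w : 0# ≤ w) (w≉0 : w ≉ 0#) {a} → a * a ≤ r → a ≤ Heron.upper-bound 0≤r r≉0 0≤w w≉0
    bound 0≤w w≉0 aa≤r = square-≤⇒≤ H.0≤upper (≤-trans aa≤r H.r≤upper²)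
      where
      module H = Heron 0≤r r≉0 0≤w w≉0
    supremum = complete (λ a → Lift (c ⊔ ℓ₁) (a * a ≤ r))
      (Start.lower-bound , lift Start.lower²≤r)
      (Start.upper-bound , λ a∈ → bound 0≤1 (λ 1≈0 → 0≉1 (sym 1≈0)) (lower a∈))
    s = proj₁ supremum
    ub = proj₁ (proj₂ supremum)
    least = proj₂ (proj₂ supremum)
    start≤s : Start.lower-bound ≤ s
    start≤s = ub (lift Start.lower²≤r)
    0≤s : 0# ≤ s
    0≤s = ≤-trans Start.0≤lower start≤s
    s≉0 : s ≉ 0#
    s≉0 s≈0 = Start.lower≉0 (antisym (≤-respʳ-≈ s≈0 start≤s) Start.0≤lower)
    module Sup = Heron 0≤r r≉0 0≤s s≉0

  fromℕ-nonNeg : ∀ k → 0# ≤ fromℕ ℝ k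
  fromℕ-nonNeg zero = ≤-refl
  fromℕ-nonNeg (suc k) = +-nonNeg 0≤1 (fromℕ-nonNeg k)

  fromℕ-suc≉0 : ∀ k → fromℕ ℝ (suc k) ≉ 0#
  fromℕ-suc≉0 k = 1+nonNeg≉0 (fromℕ-nonNeg k)

  -- Characteristic zero supplies the infinitely many distinct values from which all later
  -- substitutions are drawn.
  fromℕ-injective : ∀ j k → fromℕ ℝ j ≈ fromℕ ℝ k → j ≡ k
  fromℕ-injective zero zero _ = ≡.refl
  fromℕ-injective zero (suc k) eq = contradiction (sym eq) (fromℕ-suc≉0 k)
  fromℕ-injective (suc j) zero eq = contradiction eq (fromℕ-suc≉0 j)
  fromℕ-injective (suc j) (suc k) eq = ≡.cong suc (fromℕ-injective j k (begin
    fromℕ ℝ j                ≈⟨ solve 1 (λ a → a := (numeral 1 :+ a) :- numeral 1) refl _ ⟩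
    (1# + fromℕ ℝ j) - 1#    ≈⟨ +-congʳ eq ⟩
    (1# + fromℕ ℝ k) - 1#    ≈⟨ solve 1 (λ a → (numeral 1 :+ a) :- numeral 1 := a) refl _ ⟩
    fromℕ ℝ k                ∎))

-- Subrings generated by one further element

module RingExtensions {c ℓ} (C : CommutativeRing c ℓ) where
  open CommutativeRing C hiding (zero)
  open IntegerSolver C
  open import Relation.Binary.Reasoning.Setoid setoid

  record IsSubring {p} (S : Pred Carrier p) : Set (c ⊔ ℓ ⊔ p) where
    field
      respects : S Respects _≈_
      1-closed : S 1#
      +-closed : ∀ {a b} → S a → S b → S (a + b)
      *-closed : ∀ {a b} → S a → S b → S (a * b)
      -‿closed : ∀ {a} → S a → S (- a)

    0-closed : S 0#
    0-closed = respects (-‿inverseʳ 1#) (+-closed 1-closed (-‿closed 1-closed))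

  module _ {p} {S : Pred Carrier p} (S-subring : IsSubring S) where
    open IsSubring S-subring

    -- Horner form c₀ + x (c₁ + x (c₂ + ⋯)) with cᵢ ∈ S.
    data Horner (x : Carrier) : ℕ → Pred Carrier (c ⊔ ℓ ⊔ p) where
      nil  : ∀ {f} → f ≈ 0# → Horner x zero f
      cons : ∀ {n f} a g → S a → Horner x n g → f ≈ a + x * g → Horner x (suc n) f

    -- Since `x` may satisfy relations over `S`, coefficients need not be unique; the length is no
    -- degree and only drives recursion.
    Adjoin : Carrier → Pred Carrier (c ⊔ ℓ ⊔ p)
    Adjoin x f = ∃[ n ] Horner x n f

    module _ {x : Carrier} where

      horner-resp : ∀ {n f g} → f ≈ g → Horner x n f → Horner x n g
      horner-resp f≈g (nil eq) = nil (trans (sym f≈g) eq)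
      horner-resp f≈g (cons a h a∈ h∈ eq) = cons a h a∈ h∈ (trans (sym f≈g) eq)

      horner-+ : ∀ {m n f g} → Horner x m f → Horner x n g → Horner x (m ℕ.⊔ n) (f + g)
      horner-+ {g = g} (nil f≈0) g∈ = horner-resp (sym (trans (+-congʳ f≈0) (+-identityˡ g))) g∈
      horner-+ {f = f} f∈@(cons _ _ _ _ _) (nil g≈0) =
        horner-resp (sym (trans (+-congˡ g≈0) (+-identityʳ f))) f∈
      horner-+ (cons a f′ a∈ f′∈ f≈) (cons b g′ b∈ g′∈ g≈) =
        cons (a + b) (f′ + g′) (+-closed a∈ b∈) (horner-+ f′∈ g′∈) (trans (+-cong f≈ g≈)
          (solve 5 (λ a b x f g → (a :+ x :* f) :+ (b :+ x :* g) := (a :+ b) :+ x :* (f :+ g)) refl a b x f′ g′))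

      horner-scale : ∀ {n d f} → S d → Horner x n f → Horner x n (d * f)
      horner-scale {d = d} d∈ (nil f≈0) = nil (trans (*-congˡ f≈0) (zeroʳ d))
      horner-scale {d = d} d∈ (cons a f′ a∈ f′∈ f≈) =
        cons (d * a) (d * f′) (*-closed d∈ a∈) (horner-scale d∈ f′∈) (trans (*-congˡ f≈)
          (solve 4 (λ d a x f → d :* (a :+ x :* f) := d :* a :+ x :* (d :* f)) refl d a x f′))

      horner-shift : ∀ {n f} → Horner x n f → Horner x (suc n) (x * f)
      horner-shift {f = f} f∈ = cons 0# f 0-closed f∈ (sym (+-identityˡ _))

      horner-* : ∀ {m n f g} → Horner x m f → Horner x n g → Adjoin x (f * g)
      horner-* {g = g} (nil f≈0) g∈ = zero , nil (trans (*-congʳ f≈0) (zeroˡ g))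
      horner-* {g = g} (cons a f′ a∈ f′∈ f≈) g∈ = _ , horner-resp (sym (trans (*-congʳ f≈)
          (solve 4 (λ a x f g → (a :+ x :* f) :* g := a :* g :+ x :* (f :* g)) refl a x f′ g)))
        (horner-+ (horner-scale a∈ g∈) (horner-shift (proj₂ (horner-* f′∈ g∈))))

      scalar∈Adjoin : ∀ {a} → S a → Adjoin x a
      scalar∈Adjoin {a} a∈ = 1 , cons a 0# a∈ (nil refl)
        (solve 2 (λ a x → a := a :+ x :* numeral 0) refl a x)

      variable∈Adjoin : Adjoin x x
      variable∈Adjoin = _ , horner-resp (*-identityʳ x) (horner-shift (proj₂ (scalar∈Adjoin 1-closed)))

      adjoin-isSubring : IsSubring (Adjoin x)
      adjoin-isSubring = record
        { respects = λ { f≈g (n , f∈) → n , horner-resp f≈g f∈ }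
        ; 1-closed = scalar∈Adjoin 1-closed
        ; +-closed = λ { (_ , f∈) (_ , g∈) → _ , horner-+ f∈ g∈ }
        ; *-closed = λ { (_ , f∈) (_ , g∈) → horner-* f∈ g∈ }
        ; -‿closed = λ { {f} (n , f∈) → n , horner-resp
            (solve 1 (λ f → :- numeral 1 :* f := :- f) refl f) (horner-scale (-‿closed 1-closed) f∈) }
        }

      record Division (n : ℕ) (α f : Carrier) : Set (c ⊔ ℓ ⊔ p) where
        field
          quotient remainder : Carrier
          quotient∈ : Horner x n quotient
          remainder∈ : S remainder
          identity : f ≈ (x - α) * quotient + remainder

      -- Synthetic division: the divisor is monic, so no inverses are needed and any commutative
      -- ring will do. The quotient is one term shorter, on which later recursions rely.
      divide : ∀ {n α f} → S α → Horner x (suc n) f → Division n α f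
      divide {zero} {α} α∈ (cons a g a∈ (nil g≈0) f≈) = record
        { quotient = 0# ; remainder = a ; quotient∈ = nil refl ; remainder∈ = a∈
        ; identity = trans f≈ (trans (+-congˡ (*-congˡ g≈0))
            (solve 3 (λ a x α → a :+ x :* numeral 0 := (x :- α) :* numeral 0 :+ a) refl a x α)) }
      divide {suc n} {α} α∈ (cons a g a∈ g∈ f≈) = record
        { quotient = r + x * q
        ; remainder = a + α * r
        ; quotient∈ = cons r q remainder∈ quotient∈ refl
        ; remainder∈ = +-closed a∈ (*-closed α∈ remainder∈)
        ; identity = trans f≈ (trans (+-congˡ (*-congˡ identity))
            (solve 5 (λ a x α q r → a :+ x :* ((x :- α) :* q :+ r)
                         := (x :- α) :* (r :+ x :* q) :+ (a :+ α :* r)) refl a x α q r)) }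
        where
        open Division (divide α∈ g∈)
        q = quotient
        r = remainder

    -- Reduces claims about the whole extension to its generators; later `T` is the subring on which
    -- two evaluations agree.
    adjoin-least : ∀ {q} {T : Pred Carrier q} {x} → IsSubring T → S ⊆ T → T x → Adjoin x ⊆ T
    adjoin-least {T = T} {x} T-subring S⊆T x∈ (_ , f∈) = go f∈
      where
      module T = IsSubring T-subring
      go : ∀ {n} → Horner x n ⊆ T
      go (nil f≈0) = T.respects (sym f≈0) T.0-closed
      go (cons a g a∈ g∈ f≈) = T.respects (sym f≈) (T.+-closed (S⊆T a∈) (T.*-closed x∈ (go g∈)))

    -- Degree one in `y` is enough as soon as `y * y` lies in `S`, as it does on a circle once `x`
    -- has been adjoined.
    AdjoinSqrt : Carrier → Pred Carrier (c ⊔ ℓ ⊔ p)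
    AdjoinSqrt y f = ∃[ a ] ∃[ b ] S a × S b × f ≈ a + b * y

    scalar∈AdjoinSqrt : ∀ {y a} → S a → AdjoinSqrt y a
    scalar∈AdjoinSqrt {y} {a} a∈ = a , 0# , a∈ , 0-closed ,
      solve 2 (λ a y → a := a :+ numeral 0 :* y) refl a y

    variable∈AdjoinSqrt : ∀ {y} → AdjoinSqrt y y
    variable∈AdjoinSqrt {y} = 0# , 1# , 0-closed , 1-closed ,
      solve 1 (λ y → y := numeral 0 :+ numeral 1 :* y) refl y

    adjoinSqrt-isSubring : ∀ {y} → S (y * y) → IsSubring (AdjoinSqrt y)
    adjoinSqrt-isSubring {y} y²∈ = record
      { respects = λ { f≈g (a , b , a∈ , b∈ , f≈) → a , b , a∈ , b∈ , trans (sym f≈g) f≈ }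
      ; 1-closed = scalar∈AdjoinSqrt 1-closed
      ; +-closed = λ { (a , b , a∈ , b∈ , f≈) (d , e , d∈ , e∈ , g≈) →
          a + d , b + e , +-closed a∈ d∈ , +-closed b∈ e∈ , trans (+-cong f≈ g≈)
            (solve 5 (λ a b d e y → (a :+ b :* y) :+ (d :+ e :* y) := (a :+ d) :+ (b :+ e) :* y) refl a b d e y) }
      ; *-closed = λ { (a , b , a∈ , b∈ , f≈) (d , e , d∈ , e∈ , g≈) →
          a * d + b * e * (y * y) , a * e + b * d ,
          +-closed (*-closed a∈ d∈) (*-closed (*-closed b∈ e∈) y²∈) , +-closed (*-closed a∈ e∈) (*-closed b∈ d∈) ,
          trans (*-cong f≈ g≈)
            (solve 5 (λ a b d e y → (a :+ b :* y) :* (d :+ e :* y)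
                := (a :* d :+ b :* e :* (y :* y)) :+ (a :* e :+ b :* d) :* y) refl a b d e y) }
      ; -‿closed = λ { (a , b , a∈ , b∈ , f≈) → - a , - b , -‿closed a∈ , -‿closed b∈ , trans (-‿cong f≈)
            (solve 3 (λ a b y → :- (a :+ b :* y) := (:- a) :+ (:- b) :* y) refl a b y) }
      }

    adjoinSqrt-least : ∀ {q} {T : Pred Carrier q} {y} → IsSubring T → S ⊆ T → T y → AdjoinSqrt y ⊆ T
    adjoinSqrt-least T-subring S⊆T y∈ (a , b , a∈ , b∈ , f≈) =
      T.respects (sym f≈) (T.+-closed (S⊆T a∈) (T.*-closed (S⊆T b∈) y∈))
      where
      module T = IsSubring T-subring

    sum-of-squares-closed : ∀ {x y r} → S x → S r → (x * x + y * y) - r ≈ 0# → S (y * y)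
    sum-of-squares-closed {x} {y} {r} x∈ r∈ eq = respects (begin
      r - x * x                                      ≈⟨ +-identityˡ _ ⟨
      0# + (r - x * x)                               ≈⟨ +-congʳ eq ⟨
      ((x * x + y * y) - r) + (r - x * x)            ≈⟨ solve 3 (λ x y r → ((x :* x :+ y :* y) :- r) :+ (r :- x :* x) := y :* y) refl x y r ⟩
      y * y                                          ∎) (+-closed r∈ (-‿closed (*-closed x∈ x∈)))

-- Polynomial and rational functions of one real variable

module RationalFunctions {c ℓ₁ ℓ₂} (ℝ : CompleteOrderedField c ℓ₁ ℓ₂) where
  open CompleteOrderedField ℝ hiding (zero)
  open IsDecTotalOrder isDecTotalOrder using (_≟_)
  open OrderedField ℝ
  open IntegerSolver commutativeRing
  open import Relation.Binary.Reasoning.Setoid setoid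
  private
    functions = Pointwise.commutativeRing Carrier commutativeRing
  open RingExtensions functions

  Constant : Pred (Carrier → Carrier) (c ⊔ ℓ₁)
  Constant f = ∃[ a ] ∀ u → f u ≈ a

  constant-isSubring : IsSubring Constant
  constant-isSubring = record
    { respects = λ { f≈g (a , f≈a) → a , λ u → trans (sym (f≈g u)) (f≈a u) }
    ; 1-closed = 1# , λ _ → refl
    ; +-closed = λ { (a , f≈a) (b , g≈b) → a + b , λ u → +-cong (f≈a u) (g≈b u) }
    ; *-closed = λ { (a , f≈a) (b , g≈b) → a * b , λ u → *-cong (f≈a u) (g≈b u) }
    ; -‿closed = λ { (a , f≈a) → - a , λ u → -‿cong (f≈a u) }
    }

  -- Inside the ring of all functions, polynomial functions are generated by the constants and `id`,
  -- so the division above applies to them unchanged.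
  PolynomialFunction : ℕ → Pred (Carrier → Carrier) (c ⊔ ℓ₁)
  PolynomialFunction = Horner constant-isSubring id

  Injective : (ℕ → Carrier) → Set ℓ₁
  Injective α = ∀ j k → α j ≈ α k → j ≡ k

  tail-injective : ∀ {α} → Injective α → Injective (α ∘ suc)
  tail-injective inj j k eq = ℕ.suc-injective (inj (suc j) (suc k) eq)

  head-apart : ∀ {α} → Injective α → ∀ k → α (suc k) - α 0 ≉ 0#
  head-apart inj k eq with inj (suc k) 0 (minus≈0⇒≈ eq)
  ... | ()

  -- The remainder is a constant, hence equal to its value at `a`, which is `f a`.
  divide-root : ∀ {n f a} → PolynomialFunction (suc n) f → f a ≈ 0# →
                ∃[ g ] PolynomialFunction n g × (∀ u → f u ≈ (u - a) * g u)
  divide-root {f = f} {a} f∈ fa≈0 = quotient , quotient∈ , λ u → begin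
    f u                                  ≈⟨ identity u ⟩
    (u - a) * quotient u + remainder u   ≈⟨ +-congˡ (remainder≈0 u) ⟩
    (u - a) * quotient u + 0#            ≈⟨ +-identityʳ _ ⟩
    (u - a) * quotient u                 ∎
    where
    open Division (divide constant-isSubring (a , λ _ → refl) f∈)
    remainder≈0 : ∀ u → remainder u ≈ 0#
    remainder≈0 u = begin
      remainder u                              ≈⟨ proj₂ remainder∈ u ⟩
      proj₁ remainder∈                         ≈⟨ proj₂ remainder∈ a ⟨
      remainder a                              ≈⟨ solve 3 (λ a q r → r := (a :- a) :* q :+ r) refl a (quotient a) (remainder a) ⟩
      (a - a) * quotient a + remainder a       ≈⟨ identity a ⟨
      f a                                      ≈⟨ fa≈0 ⟩
      0#                                       ∎

  -- The point `p` certifies that `f` is not the zero function: it excludes length zero, and it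
  -- remains a certificate for the quotient.
  root-factor-≉0 : ∀ {n f a p} → PolynomialFunction n f → f a ≈ 0# → f p ≉ 0# →
                   ∃[ m ] n ≡ suc m × ∃[ g ] PolynomialFunction m g × (∀ u → f u ≈ (u - a) * g u) × g p ≉ 0#
  root-factor-≉0 {p = p} (nil f≈0) _ fp≉0 = contradiction (f≈0 p) fp≉0
  root-factor-≉0 {suc n} {a = a} {p} f∈@(cons _ _ _ _ _) fa≈0 fp≉0 with divide-root f∈ fa≈0
  ... | g , g∈ , f≈ = n , ≡.refl , g , g∈ , f≈ , λ gp≈0 → fp≉0 (trans (f≈ p) (trans (*-congˡ gp≈0) (zeroʳ _)))

  -- A root at α 0 is divided out and the search goes on along the rest of α.
  common-nonroot : ∀ {m n f g p q α} → PolynomialFunction m f → PolynomialFunction n g →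
                   f p ≉ 0# → g q ≉ 0# → Injective α → ∃[ k ] f (α k) ≉ 0# × g (α k) ≉ 0#
  common-nonroot {f = f} {g} {α = α} f∈ g∈ fp≉0 gq≉0 inj with f (α 0) ≟ 0# | g (α 0) ≟ 0#
  ... | no f≉0 | no g≉0 = 0 , f≉0 , g≉0
  ... | yes f≈0 | _ with root-factor-≉0 f∈ f≈0 fp≉0
  -- Matching the equation exposes the length as a successor; every call shortens one of the two
  -- Horner forms, so the search ends.
  ...   | _ , ≡.refl , f′ , f′∈ , f≈ , f′p≉0 with common-nonroot f′∈ g∈ f′p≉0 gq≉0 (tail-injective inj)
  ...     | k , f′≉0 , g≉0 = suc k , (λ eq → *-≉0 (head-apart inj k) f′≉0 (trans (sym (f≈ _)) eq)) , g≉0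
  common-nonroot {α = α} f∈ g∈ fp≉0 gq≉0 inj | no _ | yes g≈0 with root-factor-≉0 g∈ g≈0 gq≉0
  ...   | _ , ≡.refl , g′ , g′∈ , g≈ , g′q≉0 with common-nonroot f∈ g′∈ fp≉0 g′q≉0 (tail-injective inj)
  ...     | k , f≉0 , g′≉0 = suc k , f≉0 , (λ eq → *-≉0 (head-apart inj k) g′≉0 (trans (sym (g≈ _)) eq))

  private
    module Poly = IsSubring (adjoin-isSubring constant-isSubring {id})

  -- With a denominator that is nowhere zero, `h` is defined everywhere and vanishes exactly where
  -- its numerator does; no reduced fraction is required.
  record Rational (h : Carrier → Carrier) : Set (c ⊔ ℓ₁) where
    field
      numerator denominator : Carrier → Carrier
      numerator∈ : Adjoin constant-isSubring id numerator
      denominator∈ : Adjoin constant-isSubring id denominator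
      denominator≉0 : ∀ u → denominator u ≉ 0#
      clears : ∀ u → h u * denominator u ≈ numerator u

  open Rational

  polynomial-rational : ∀ {f} → Adjoin constant-isSubring id f → Rational f
  polynomial-rational f∈ = record
    { numerator∈ = f∈
    ; denominator∈ = Poly.1-closed
    ; denominator≉0 = λ _ 1≈0 → 0≉1 (sym 1≈0)
    ; clears = λ _ → *-identityʳ _
    }

  constant-rational : ∀ a → Rational (const a)
  constant-rational a = polynomial-rational (scalar∈Adjoin constant-isSubring (a , λ _ → refl))

  id-rational : Rational id
  id-rational = polynomial-rational (variable∈Adjoin constant-isSubring)

  +-rational : ∀ {h k} → Rational h → Rational k → Rational (λ u → h u + k u)
  +-rational {h} {k} H K = record
    { numerator∈ = Poly.+-closed (Poly.*-closed (numerator∈ H) (denominator∈ K))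
                                 (Poly.*-closed (numerator∈ K) (denominator∈ H))
    ; denominator∈ = Poly.*-closed (denominator∈ H) (denominator∈ K)
    ; denominator≉0 = λ u → *-≉0 (denominator≉0 H u) (denominator≉0 K u)
    ; clears = λ u → trans
        (solve 4 (λ a b d e → (a :+ b) :* (d :* e) := a :* d :* e :+ b :* e :* d) refl
          (h u) (k u) (denominator H u) (denominator K u))
        (+-cong (*-congʳ (clears H u)) (*-congʳ (clears K u)))
    }

  *-rational : ∀ {h k} → Rational h → Rational k → Rational (λ u → h u * k u)
  *-rational {h} {k} H K = record
    { numerator∈ = Poly.*-closed (numerator∈ H) (numerator∈ K)
    ; denominator∈ = Poly.*-closed (denominator∈ H) (denominator∈ K)
    ; denominator≉0 = λ u → *-≉0 (denominator≉0 H u) (denominator≉0 K u)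
    ; clears = λ u → trans
        (solve 4 (λ a b d e → a :* b :* (d :* e) := a :* d :* (b :* e)) refl
          (h u) (k u) (denominator H u) (denominator K u))
        (*-cong (clears H u) (clears K u))
    }

  -‿rational : ∀ {h} → Rational h → Rational (λ u → - h u)
  -‿rational {h} H = record
    { numerator∈ = Poly.-‿closed (numerator∈ H)
    ; denominator∈ = denominator∈ H
    ; denominator≉0 = denominator≉0 H
    ; clears = λ u → trans
        (solve 2 (λ a d → (:- a) :* d := :- (a :* d)) refl (h u) (denominator H u))
        (-‿cong (clears H u))
    }

  ⁻¹-rational : ∀ {h} → Rational h → (∀ u → h u ≉ 0#) → Rational (λ u → h u ⁻¹)
  ⁻¹-rational {h} H h≉0 = record
    { numerator∈ = denominator∈ H
    ; denominator∈ = numerator∈ H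
    ; denominator≉0 = λ u n≈0 → *-≉0 (h≉0 u) (denominator≉0 H u) (trans (clears H u) n≈0)
    ; clears = λ u → begin
        h u ⁻¹ * numerator H u              ≈⟨ *-congˡ (clears H u) ⟨
        h u ⁻¹ * (h u * denominator H u)    ≈⟨ solve 3 (λ i a d → i :* (a :* d) := a :* i :* d) refl (h u ⁻¹) (h u) (denominator H u) ⟩
        h u * h u ⁻¹ * denominator H u      ≈⟨ *-congʳ (⁻¹-inverseʳ (h≉0 u)) ⟩
        1# * denominator H u                ≈⟨ *-identityˡ _ ⟩
        denominator H u                     ∎
    }

  -- Passing to numerators leaves two polynomial functions, and the search runs through the natural
  -- numbers.
  common-nonzero : ∀ {h k p q} → Rational h → Rational k → h p ≉ 0# → k q ≉ 0# →
                   ∃[ u ] h u ≉ 0# × k u ≉ 0#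
  common-nonzero {h} {k} {p} {q} H K hp≉0 kq≉0
    with common-nonroot (proj₂ (numerator∈ H)) (proj₂ (numerator∈ K))
           (numerator≉0 H p hp≉0) (numerator≉0 K q kq≉0) fromℕ-injective
    where
    numerator≉0 : ∀ {f} (F : Rational f) a → f a ≉ 0# → numerator F a ≉ 0#
    numerator≉0 F a fa≉0 n≈0 = *-≉0 fa≉0 (denominator≉0 F a) (trans (clears F a) n≈0)
  ... | j , hj≉0 , kj≉0 = fromℕ ℝ j , nonzero H hj≉0 , nonzero K kj≉0
    where
    nonzero : ∀ {f} (F : Rational f) {a} → numerator F a ≉ 0# → f a ≉ 0#
    nonzero F n≉0 fa≈0 = n≉0 (trans (sym (clears F _)) (trans (*-congʳ fa≈0) (zeroˡ _)))

-- Evaluation of polynomial expressions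

module Evaluation {c ℓ w} (R : CommutativeRing c ℓ) (X : Set w) where
  private
    module R = CommutativeRing R
  open PolynomialRing R X

  eval : (X → R.Carrier) → Polynomial → R.Carrier
  eval ρ (con a) = a
  eval ρ (var v) = ρ v
  eval ρ (f :+ g) = eval ρ f R.+ eval ρ g
  eval ρ (f :* g) = eval ρ f R.* eval ρ g
  eval ρ (:- f) = R.- eval ρ f

  eval-≋ : ∀ ρ {f g} → f ≋ g → eval ρ f R.≈ eval ρ g
  eval-≋ ρ refl = R.refl
  eval-≋ ρ (sym e) = R.sym (eval-≋ ρ e)
  eval-≋ ρ (trans e e′) = R.trans (eval-≋ ρ e) (eval-≋ ρ e′)
  eval-≋ ρ (con-cong a≈b) = a≈b
  eval-≋ ρ (con-+ a b) = R.refl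
  eval-≋ ρ (con-* a b) = R.refl
  eval-≋ ρ (+-cong e e′) = R.+-cong (eval-≋ ρ e) (eval-≋ ρ e′)
  eval-≋ ρ (+-assoc f g h) = R.+-assoc _ _ _
  eval-≋ ρ (+-comm f g) = R.+-comm _ _
  eval-≋ ρ (+-identityˡ f) = R.+-identityˡ _
  eval-≋ ρ (-‿cong e) = R.-‿cong (eval-≋ ρ e)
  eval-≋ ρ (-‿inverseˡ f) = R.-‿inverseˡ _
  eval-≋ ρ (*-cong e e′) = R.*-cong (eval-≋ ρ e) (eval-≋ ρ e′)
  eval-≋ ρ (*-assoc f g h) = R.*-assoc _ _ _
  eval-≋ ρ (*-comm f g) = R.*-comm _ _
  eval-≋ ρ (*-identityˡ f) = R.*-identityˡ _
  eval-≋ ρ (distribˡ f g h) = R.distribˡ _ _ _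

  eval-cong : ∀ {ρ σ} → (∀ v → ρ v R.≈ σ v) → ∀ f → eval ρ f R.≈ eval σ f
  eval-cong ρ≈σ (con a) = R.refl
  eval-cong ρ≈σ (var v) = ρ≈σ v
  eval-cong ρ≈σ (f :+ g) = R.+-cong (eval-cong ρ≈σ f) (eval-cong ρ≈σ g)
  eval-cong ρ≈σ (f :* g) = R.*-cong (eval-cong ρ≈σ f) (eval-cong ρ≈σ g)
  eval-cong ρ≈σ (:- f) = R.-‿cong (eval-cong ρ≈σ f)

-- The rational parametrisation of the circle

module Parametrisation {c ℓ₁ ℓ₂} (ℝ : CompleteOrderedField c ℓ₁ ℓ₂) (s : CompleteOrderedField.Carrier ℝ) where
  open CompleteOrderedField ℝ hiding (zero)
  open OrderedField ℝ
  open RationalFunctions ℝ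
  open IntegerSolver commutativeRing
  open import Relation.Binary.Reasoning.Setoid setoid

  1+t²≉0 : ∀ t → 1# + t * t ≉ 0#
  1+t²≉0 t = 1+nonNeg≉0 (square-nonNeg t)

  -- Congruence of the inverse is not an axiom of the field; at nonzero arguments it follows from
  -- uniqueness of inverses.
  ⁻¹-cong : ∀ {a b} → a ≉ 0# → a ≈ b → a ⁻¹ ≈ b ⁻¹
  ⁻¹-cong {a} {b} a≉0 a≈b = begin
    a ⁻¹                  ≈⟨ *-identityˡ _ ⟨
    1# * a ⁻¹             ≈⟨ *-congʳ (⁻¹-inverseʳ (λ b≈0 → a≉0 (trans a≈b b≈0))) ⟨
    b * b ⁻¹ * a ⁻¹       ≈⟨ *-congʳ (*-congʳ a≈b) ⟨
    a * b ⁻¹ * a ⁻¹       ≈⟨ solve 3 (λ a i j → a :* j :* i := a :* i :* j) refl a (a ⁻¹) (b ⁻¹) ⟩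
    a * a ⁻¹ * b ⁻¹       ≈⟨ *-congʳ (⁻¹-inverseʳ a≉0) ⟩
    1# * b ⁻¹             ≈⟨ *-identityˡ _ ⟩
    b ⁻¹                  ∎

  xc yc : Carrier → Carrier
  xc t = s * ((1# - t * t) * (1# + t * t) ⁻¹)
  yc t = s * ((t + t) * (1# + t * t) ⁻¹)

  -- The identity `(1 - t²)² + (2t)² = (1 + t²)²`, divided by the square of the denominator.
  on-circle : ∀ t → xc t * xc t + yc t * yc t ≈ s * s
  on-circle t = begin
    xc t * xc t + yc t * yc t
      ≈⟨ solve 4 (λ s a b i → s :* (a :* i) :* (s :* (a :* i)) :+ s :* (b :* i) :* (s :* (b :* i))
                           := s :* s :* (i :* i :* (a :* a :+ b :* b))) refl s (1# - t * t) (t + t) i ⟩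
    s * s * (i * i * ((1# - t * t) * (1# - t * t) + (t + t) * (t + t)))
      ≈⟨ *-congˡ (*-congˡ (solve 1 (λ t → (numeral 1 :- t :* t) :* (numeral 1 :- t :* t) :+ (t :+ t) :* (t :+ t)
                                     := (numeral 1 :+ t :* t) :* (numeral 1 :+ t :* t)) refl t)) ⟩
    s * s * (i * i * (d * d))
      ≈⟨ *-congˡ (solve 2 (λ i d → i :* i :* (d :* d) := d :* i :* (d :* i)) refl i d) ⟩
    s * s * (d * i * (d * i))
      ≈⟨ *-congˡ (*-cong (⁻¹-inverseʳ (1+t²≉0 t)) (⁻¹-inverseʳ (1+t²≉0 t))) ⟩
    s * s * (1# * 1#)
      ≈⟨ solve 1 (λ s → s :* s :* (numeral 1 :* numeral 1) := s :* s) refl s ⟩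
    s * s ∎
    where
    d = 1# + t * t
    i = d ⁻¹

  denominator-cong : ∀ {t u} → t * t ≈ u * u → (1# + t * t) ⁻¹ ≈ (1# + u * u) ⁻¹
  denominator-cong eq = ⁻¹-cong (1+t²≉0 _) (+-congˡ eq)

  xc-cong² : ∀ {t u} → t * t ≈ u * u → xc t ≈ xc u
  xc-cong² eq = *-congˡ (*-cong (+-congˡ (-‿cong eq)) (denominator-cong eq))

  yc-cong : ∀ {t u} → t ≈ u → yc t ≈ yc u
  yc-cong eq = *-congˡ (*-cong (+-cong eq eq) (denominator-cong (*-cong eq eq)))

  neg-square : ∀ t → - t * - t ≈ t * t
  neg-square = solve 1 (λ t → (:- t) :* (:- t) := t :* t) refl

  -- Changing the sign of the parameter reflects the circle in the horizontal axis, which yields the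
  -- two points with equal `x` and opposite `y`.
  xc-even : ∀ t → xc (- t) ≈ xc t
  xc-even t = xc-cong² (neg-square t)

  yc-odd : ∀ t → yc (- t) ≈ - yc t
  yc-odd t = trans (*-congˡ (*-congˡ (denominator-cong (neg-square t))))
    (solve 3 (λ s t i → s :* ((:- t :+ :- t) :* i) := :- (s :* ((t :+ t) :* i))) refl s t ((1# + t * t) ⁻¹))

  module _ (s≉0 : s ≉ 0#) where

    -- Clearing denominators turns the equation into `2s(u² - t²) = 0`, where `s` and `2` are
    -- nonzero.
    xc-injective² : ∀ {t u} → xc t ≈ xc u → t * t ≈ u * u
    xc-injective² {t} {u} eq =
      [ flip contradiction s≉0
      , [ flip contradiction (1+nonNeg≉0 0≤1) , (λ z≈0 → sym (minus≈0⇒≈ z≈0)) ]′ ∘ zero-product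
      ]′ (zero-product scaled)
      where
      i = (1# + t * t) ⁻¹
      j = (1# + u * u) ⁻¹
      scaled : s * ((1# + 1#) * (u * u - t * t)) ≈ 0#
      scaled = begin
        s * ((1# + 1#) * (u * u - t * t))
          ≈⟨ solve 3 (λ s p q → s :* (numeral 2 :* (q :- p))
               := s :* (numeral 1 :- p) :* (numeral 1 :+ q) :- s :* (numeral 1 :- q) :* (numeral 1 :+ p))
               refl s (t * t) (u * u) ⟩
        s * (1# - t * t) * (1# + u * u) - s * (1# - u * u) * (1# + t * t)
          ≈⟨ +-cong (clear t u) (-‿cong (clear u t)) ⟩
        xc t * ((1# + t * t) * (1# + u * u)) - xc u * ((1# + u * u) * (1# + t * t))
          ≈⟨ +-congʳ (*-congʳ eq) ⟩
        xc u * ((1# + t * t) * (1# + u * u)) - xc u * ((1# + u * u) * (1# + t * t))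
          ≈⟨ solve 3 (λ z d e → z :* (d :* e) :- z :* (e :* d) := numeral 0) refl (xc u) (1# + t * t) (1# + u * u) ⟩
        0# ∎
        where
        clear : ∀ t u → s * (1# - t * t) * (1# + u * u) ≈ xc t * ((1# + t * t) * (1# + u * u))
        clear t u = sym (begin
          xc t * ((1# + t * t) * (1# + u * u))
            ≈⟨ solve 5 (λ s a i d e → s :* (a :* i) :* (d :* e) := s :* a :* e :* (d :* i)) refl
                 s (1# - t * t) ((1# + t * t) ⁻¹) (1# + t * t) (1# + u * u) ⟩
          s * (1# - t * t) * (1# + u * u) * ((1# + t * t) * (1# + t * t) ⁻¹)
            ≈⟨ *-congˡ (⁻¹-inverseʳ (1+t²≉0 t)) ⟩
          s * (1# - t * t) * (1# + u * u) * 1#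
            ≈⟨ *-identityʳ _ ⟩
          s * (1# - t * t) * (1# + u * u) ∎)

    yc-≉0 : ∀ {t} → t ≉ 0# → yc t ≉ 0#
    yc-≉0 {t} t≉0 = *-≉0 s≉0 (*-≉0 t+t≉0 (⁻¹-≉0 (1+t²≉0 t)))
      where
      t+t≉0 : t + t ≉ 0#
      t+t≉0 eq = *-≉0 (1+nonNeg≉0 0≤1) t≉0 (trans (solve 1 (λ t → numeral 2 :* t := t :+ t) refl t) eq)

    -- Abscissas determine the parameter only up to sign; restricting to positive parameters
    -- excludes `t = -u`.
    positive-xc-injective : Injective (xc ∘ fromℕ ℝ ∘ suc)
    positive-xc-injective j k eq =
      [ (λ t-u≈0 → ℕ.suc-injective (fromℕ-injective (suc j) (suc k) (minus≈0⇒≈ t-u≈0)))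
      , flip contradiction (+-≉0 (fromℕ-nonNeg (suc j)) (fromℕ-suc≉0 j) (fromℕ-nonNeg (suc k)))
      ]′ (zero-product factored)
      where
      t = fromℕ ℝ (suc j)
      u = fromℕ ℝ (suc k)
      factored : (t - u) * (t + u) ≈ 0#
      factored = begin
        (t - u) * (t + u)    ≈⟨ solve 2 (λ t u → (t :- u) :* (t :+ u) := t :* t :- u :* u) refl t u ⟩
        t * t - u * u        ≈⟨ +-congʳ (xc-injective² eq) ⟩
        u * u - u * u        ≈⟨ -‿inverseʳ _ ⟩
        0#                   ∎

  -- Constrained pairs run over the circle through the first parameter, free
  -- pairs over the plane.
  xCoord yCoord : Bool → Carrier × Carrier → Carrier
  xCoord true (t , _) = xc t
  xCoord false (t , _) = t
  yCoord true (t , _) = yc t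
  yCoord false (_ , u) = u

  xCoord-cong : ∀ b {t u t′ u′} → t ≈ t′ → u ≈ u′ → xCoord b (t , u) ≈ xCoord b (t′ , u′)
  xCoord-cong true t≈ u≈ = xc-cong² (*-cong t≈ t≈)
  xCoord-cong false t≈ u≈ = t≈

  yCoord-cong : ∀ b {t u t′ u′} → t ≈ t′ → u ≈ u′ → yCoord b (t , u) ≈ yCoord b (t′ , u′)
  yCoord-cong true t≈ u≈ = yc-cong t≈
  yCoord-cong false t≈ u≈ = u≈

  module _ {g h : Carrier → Carrier} (G : Rational g) (H : Rational h) where
    private
      1+g²⁻¹ : Rational (λ u → (1# + g u * g u) ⁻¹)
      1+g²⁻¹ = ⁻¹-rational (+-rational (constant-rational 1#) (*-rational G G)) (λ u → 1+t²≉0 (g u))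

    xCoord-rational : ∀ b → Rational (λ u → xCoord b (g u , h u))
    xCoord-rational true = *-rational (constant-rational s) (*-rational
      (+-rational (constant-rational 1#) (-‿rational (*-rational G G))) 1+g²⁻¹)
    xCoord-rational false = G

    yCoord-rational : ∀ b → Rational (λ u → yCoord b (g u , h u))
    yCoord-rational true = *-rational (constant-rational s) (*-rational (+-rational G G) 1+g²⁻¹)
    yCoord-rational false = H

-- Ideal membership as equality in the quotient

module QuotientRing {c ℓ p} (R : CommutativeRing c ℓ) (I : Ideal R p) where
  private
    module R = CommutativeRing R
    module R/I = CommutativeRing (R / I)
  open Ideal I using (respects; 0-closed)

  ≈⇒≈/I : ∀ {f g} → f R.≈ g → f R/I.≈ g
  ≈⇒≈/I {g = g} f≈g = respects (R.sym (R.trans (R.+-congʳ f≈g) (R.-‿inverseʳ g))) 0-closed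

  minus-zero : ∀ f → f R.- R.0# R.≈ f
  minus-zero f = R.trans (R.+-congˡ (RingProperties.-0#≈0# R.ring)) (R.+-identityʳ f)

  ∈⇒≈0 : ∀ {f} → f ∈ ⟦ I ⟧ → f R/I.≈ R.0#
  ∈⇒≈0 = respects (R.sym (minus-zero _))

  ≈0⇒∈ : ∀ {f} → f R/I.≈ R.0# → f ∈ ⟦ I ⟧
  ≈0⇒∈ = respects (minus-zero _)

-- The dichotomy between zero and a point of nonvanishing

module Nonvanishing {c ℓ₁ ℓ₂ a ℓ w} (ℝ : CompleteOrderedField c ℓ₁ ℓ₂) (C : CommutativeRing a ℓ)
  {Point : Set w} (at : Point → CommutativeRing.Carrier C → CompleteOrderedField.Carrier ℝ)
  (at-isHomomorphism : ∀ p → IsRingHomomorphism (CommutativeRing.rawRing C) (CompleteOrderedField.rawRing ℝ) (at p))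
  where
  open CompleteOrderedField ℝ hiding (zero)
  open IsDecTotalOrder isDecTotalOrder using (_≟_)
  open OrderedField ℝ
  open RationalFunctions ℝ using (Injective; tail-injective; head-apart)
  open IntegerSolver commutativeRing
  open RingExtensions C
  open import Relation.Binary.Reasoning.Setoid setoid
  private
    module C = CommutativeRing C
    module Sol = IntegerSolver C
    module At p = IsRingHomomorphism (at-isHomomorphism p)

  Agree : Point → Point → Pred C.Carrier ℓ₁
  Agree p q f = at p f ≈ at q f

  agree-isSubring : ∀ {p q} → IsSubring (Agree p q)
  agree-isSubring {p} {q} = record
    { respects = λ f≈g eq → trans (At.⟦⟧-cong p (C.sym f≈g)) (trans eq (At.⟦⟧-cong q f≈g))
    ; 1-closed = trans (At.1#-homo p) (sym (At.1#-homo q))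
    ; +-closed = λ eq eq′ → trans (At.+-homo p _ _) (trans (+-cong eq eq′) (sym (At.+-homo q _ _)))
    ; *-closed = λ eq eq′ → trans (At.*-homo p _ _) (trans (*-cong eq eq′) (sym (At.*-homo q _ _)))
    ; -‿closed = λ eq → trans (At.-‿homo p _) (trans (-‿cong eq) (sym (At.-‿homo q _)))
    }

  -- Stronger than deciding equality with zero: the negative answer carries a point, which the next
  -- extension modifies to find its own.
  Decidable : ∀ {p} → Pred C.Carrier p → Set (ℓ₁ ⊔ a ⊔ ℓ ⊔ w ⊔ p)
  Decidable S = ∀ {f} → f ∈ S → f C.≈ C.0# ⊎ ∃[ p ] at p f ≉ 0#

  at-linear : ∀ p {f z d q r} → f C.≈ (z C.- d) C.* q C.+ r →
              at p f ≈ (at p z - at p d) * at p q + at p r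
  at-linear p f≈ = trans (At.⟦⟧-cong p f≈) (trans (At.+-homo p _ _) (+-congʳ (trans (At.*-homo p _ _)
    (*-congʳ (trans (At.+-homo p _ _) (+-congˡ (At.-‿homo p _)))))))

  module _ {ℓ′} {S : Pred C.Carrier ℓ′} (S-subring : IsSubring S) where

    -- Divide by z - α 0: either the remainder is nonzero at some point, where
    -- z can be set to α 0, or the quotient decides and z is set to another α k.
    horner-decide : Decidable S → ∀ {α z} → Injective α →
                    (∀ k → ∃[ d ] S d × ∀ p → at p d ≈ α k) →
                    (σ : ℕ → Point → Point) → (∀ k p → at (σ k p) z ≈ α k) →
                    (∀ k p → S ⊆ Agree (σ k p) p) →
                    ∀ {m f} → Horner S-subring z m f →
                    f C.≈ C.0# ⊎ ∃[ k ] ∃[ p ] at (σ k p) f ≉ 0#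
    horner-decide dec inj α∈ σ z-at S-at (nil f≈0) = inj₁ f≈0
    horner-decide dec {α} {z} inj α∈ σ z-at S-at {f = f} f∈@(cons _ _ _ _ _) = by-remainder (dec remainder∈)
      where
      open Division (divide S-subring (proj₁ (proj₂ (α∈ 0))) f∈)

      at-f : ∀ k p → at (σ k p) f ≈ (α k - α 0) * at (σ k p) quotient + at (σ k p) remainder
      at-f k p = trans (at-linear (σ k p) identity)
        (+-congʳ (*-congʳ (+-cong (z-at k p) (-‿cong (proj₂ (proj₂ (α∈ 0)) (σ k p))))))

      by-quotient : remainder C.≈ C.0# → quotient C.≈ C.0# ⊎ ∃[ k ] ∃[ p ] at (σ (suc k) p) quotient ≉ 0# →
                    f C.≈ C.0# ⊎ ∃[ k ] ∃[ p ] at (σ k p) f ≉ 0#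
      by-quotient r≈0 (inj₁ q≈0) = inj₁ (C.trans identity (C.trans (C.+-cong (C.*-congˡ q≈0) r≈0)
        (Sol.solve 1 (λ d → d Sol.:* Sol.numeral 0 Sol.:+ Sol.numeral 0 Sol.:= Sol.numeral 0) C.refl _)))
      by-quotient r≈0 (inj₂ (k , p , q≉0)) = inj₂ (suc k , p , λ f≈0 → *-≉0 (head-apart inj k) q≉0 (begin
        (α (suc k) - α 0) * at o quotient                      ≈⟨ +-identityʳ _ ⟨
        (α (suc k) - α 0) * at o quotient + 0#                 ≈⟨ +-congˡ (trans (At.⟦⟧-cong o r≈0) (At.0#-homo o)) ⟨
        (α (suc k) - α 0) * at o quotient + at o remainder     ≈⟨ at-f (suc k) p ⟨
        at o f                                                 ≈⟨ f≈0 ⟩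
        0#                                                     ∎))
        where
        o = σ (suc k) p

      by-remainder : remainder C.≈ C.0# ⊎ ∃[ p ] at p remainder ≉ 0# → f C.≈ C.0# ⊎ ∃[ k ] ∃[ p ] at (σ k p) f ≉ 0#
      -- Now `f` is `z - α 0` times the quotient, so the value `α 0` is spent and the search
      -- continues from `α 1`, where that factor is nonzero.
      by-remainder (inj₁ r≈0) = by-quotient r≈0
        (horner-decide dec (tail-injective inj) (α∈ ∘ suc) (σ ∘ suc) (z-at ∘ suc) (λ k → S-at (suc k)) quotient∈)
      by-remainder (inj₂ (p , r≉0)) = inj₂ (0 , p , λ f≈0 → r≉0 (begin
        at p remainder                                         ≈⟨ S-at 0 p remainder∈ ⟨
        at (σ 0 p) remainder                                   ≈⟨ solve 3 (λ a q r → r := (a :- a) :* q :+ r) refl (α 0) (at (σ 0 p) quotient) _ ⟩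
        (α 0 - α 0) * at (σ 0 p) quotient + at (σ 0 p) remainder ≈⟨ at-f 0 p ⟨
        at (σ 0 p) f                                           ≈⟨ f≈0 ⟩
        0#                                                     ∎))

    -- The two values a ± b y of f at p and p′ add up to 2 a.
    sqrt-decide : ∀ {y} → (∀ {f} → S f → f C.≈ C.0# ⊎
                    ∃[ p ] at p f ≉ 0# × at p y ≉ 0# × ∃[ p′ ] S ⊆ Agree p p′ × at p′ y ≈ - at p y) →
                  Decidable (AdjoinSqrt S-subring y)
    sqrt-decide {y} dec {f} (a , b , a∈ , b∈ , f≈) = by-a (dec a∈)
      where
      at-f : ∀ p → at p f ≈ at p a + at p b * at p y
      at-f p = trans (At.⟦⟧-cong p f≈) (trans (At.+-homo p _ _) (+-congˡ (At.*-homo p _ _)))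

      by-b : a C.≈ C.0# → b C.≈ C.0# ⊎
               (∃[ p ] at p b ≉ 0# × at p y ≉ 0# × ∃[ p′ ] S ⊆ Agree p p′ × at p′ y ≈ - at p y) →
             f C.≈ C.0# ⊎ ∃[ p ] at p f ≉ 0#
      by-b a≈0 (inj₁ b≈0) = inj₁ (C.trans f≈ (C.trans (C.+-cong a≈0 (C.*-congʳ b≈0))
        (Sol.solve 1 (λ y → Sol.numeral 0 Sol.:+ Sol.numeral 0 Sol.:* y Sol.:= Sol.numeral 0) C.refl y)))
      -- Here `f` takes the value `b y`, so the witness for `b` must also keep `y` away from zero.
      by-b a≈0 (inj₂ (p , b≉0 , y≉0 , _)) = inj₂ (p , λ f≈0 → *-≉0 b≉0 y≉0 (begin
        at p b * at p y              ≈⟨ +-identityˡ _ ⟨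
        0# + at p b * at p y         ≈⟨ +-congʳ (trans (At.⟦⟧-cong p a≈0) (At.0#-homo p)) ⟨
        at p a + at p b * at p y     ≈⟨ at-f p ⟨
        at p f                       ≈⟨ f≈0 ⟩
        0#                           ∎))

      by-a : a C.≈ C.0# ⊎ (∃[ p ] at p a ≉ 0# × at p y ≉ 0# × ∃[ p′ ] S ⊆ Agree p p′ × at p′ y ≈ - at p y) →
             f C.≈ C.0# ⊎ ∃[ p ] at p f ≉ 0#
      by-a (inj₁ a≈0) = by-b a≈0 (dec b∈)
      by-a (inj₂ (p , a≉0 , y≉0 , p′ , S-agree , y′≈)) with at p f ≟ 0#
      ... | no f≉0 = inj₂ (p , f≉0)
      ... | yes f≈0 = inj₂ (p′ , λ f′≈0 → *-≉0 (1+nonNeg≉0 0≤1) a≉0 (begin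
        (1# + 1#) * at p a
          ≈⟨ solve 3 (λ a b y → numeral 2 :* a := (a :+ b :* y) :+ (a :+ b :* (:- y))) refl (at p a) (at p b) (at p y) ⟩
        (at p a + at p b * at p y) + (at p a + at p b * - at p y)
          ≈⟨ +-congˡ (+-cong (S-agree a∈) (*-cong (S-agree b∈) (sym y′≈))) ⟩
        (at p a + at p b * at p y) + (at p′ a + at p′ b * at p′ y)
          ≈⟨ +-cong (at-f p) (at-f p′) ⟨
        at p f + at p′ f
          ≈⟨ +-cong f≈0 f′≈0 ⟩
        0# + 0#
          ≈⟨ +-identityˡ 0# ⟩
        0# ∎))

-- Primality of ideals cut out by circles

module CircleIdeals {c ℓ₁ ℓ₂} (ℝ : CompleteOrderedField c ℓ₁ ℓ₂)
  {r s : CompleteOrderedField.Carrier ℝ}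
  (s²≈r : CompleteOrderedField._≈_ ℝ (CompleteOrderedField._*_ ℝ s s) r)
  (s≉0 : CompleteOrderedField._≉_ ℝ s (CompleteOrderedField.0# ℝ))
  (n : ℕ) where

  open CompleteOrderedField ℝ hiding (zero)
  open IsDecTotalOrder isDecTotalOrder using (_≟_)
  open OrderedField ℝ
  open RationalFunctions ℝ
  open Parametrisation ℝ s
  open PolynomialRing commutativeRing (Var n) using (Polynomial; con; var; con-cong; con-+; con-*; _:+_; _:*_; :-_)
  open Evaluation commutativeRing (Var n)
  open IntegerSolver commutativeRing using (solve; _:=_; numeral) renaming (_:+_ to _⊕_; _:*_ to _⊗_; _:-_ to _⊖_; :-_ to ⊝_)
  open import Relation.Binary.Reasoning.Setoid setoid
  open RingProperties ring using (-0#≈0#)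
  private
    module P = CommutativeRing (ℝ[x,y] ℝ n)

  Pair : Set
  Pair = Fin n × Fin n

  Point : Set c
  Point = Pair → Carrier × Carrier

  -- The origin of parameter space: constrained pairs sit at `(s , 0)` on their circle, and only
  -- free pairs sit at `(0 , 0)`.
  origin : Point
  origin _ = 0# , 0#

  x y circle : Pair → Polynomial
  x (i , j) = var (xᵥ i j)
  y (i , j) = var (yᵥ i j)
  circle κ = (x κ P.* x κ P.+ y κ P.* y κ) P.- con r

  _[_↦_] : Point → Pair → Carrier × Carrier → Point
  (p [ κ ↦ v ]) κ′ with ≡-dec Fin._≟_ Fin._≟_ κ κ′
  ... | yes _ = v
  ... | no _ = p κ′

  update-same : ∀ p κ v → (p [ κ ↦ v ]) κ ≡ v
  update-same p κ v with ≡-dec Fin._≟_ Fin._≟_ κ κ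
  ... | yes _ = ≡.refl
  ... | no κ≢κ = contradiction ≡.refl κ≢κ

  update-other : ∀ p {κ κ′} v → κ ≢ κ′ → (p [ κ ↦ v ]) κ′ ≡ p κ′
  update-other p {κ} {κ′} v κ≢κ′ with ≡-dec Fin._≟_ Fin._≟_ κ κ′
  ... | yes κ≡κ′ = contradiction κ≡κ′ κ≢κ′
  ... | no _ = ≡.refl

  -- A mask lets one argument cover both `J`, where every pair is constrained, and the ideals of the
  -- initial segments of the regular sequence.
  module _ (constrained : Pair → Bool) where

    coordinate : Point → Var n → Carrier
    coordinate p (xᵥ i j) = xCoord (constrained (i , j)) (p (i , j))
    coordinate p (yᵥ i j) = yCoord (constrained (i , j)) (p (i , j))

    infix 10 _at_
    _at_ : Polynomial → Point → Carrier
    f at p = eval (coordinate p) f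

    circle-at : ∀ {κ} → constrained κ ≡ true → ∀ p → circle κ at p ≈ 0#
    circle-at {κ} eq p = trans (+-congʳ (go (constrained κ) eq)) (trans (+-congʳ s²≈r) (-‿inverseʳ r))
      where
      go : ∀ b → b ≡ true → xCoord b (p κ) * xCoord b (p κ) + yCoord b (p κ) * yCoord b (p κ) ≈ s * s
      go true _ = on-circle (proj₁ (p κ))

    circle-at-origin : ∀ {κ} → constrained κ ≡ false → circle κ at origin ≉ 0#
    circle-at-origin {κ} eq = go (constrained κ) eq
      where
      go : ∀ b → b ≡ false → (xCoord b (0# , 0#) * xCoord b (0# , 0#) + yCoord b (0# , 0#) * yCoord b (0# , 0#)) - r ≉ 0#
      go false _ circle≈0 = *-≉0 s≉0 s≉0 (begin
        s * s                              ≈⟨ s²≈r ⟩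
        r                                  ≈⟨ solve 1 (λ r → r := ⊝ ((numeral 0 ⊗ numeral 0 ⊕ numeral 0 ⊗ numeral 0) ⊖ r)) refl r ⟩
        - ((0# * 0# + 0# * 0#) - r)        ≈⟨ -‿cong circle≈0 ⟩
        - 0#                               ≈⟨ -0#≈0# ⟩
        0#                                 ∎)

    -- Drawn in parameter space, which is affine; a straight line between two points of the circles
    -- themselves would leave them.
    segment : Point → Point → Carrier → Point
    segment p q u κ = proj₁ (p κ) + u * (proj₁ (q κ) - proj₁ (p κ)) , proj₂ (p κ) + u * (proj₂ (q κ) - proj₂ (p κ))

    segment-rational : ∀ p q f → Rational (λ u → f at segment p q u)
    segment-rational p q = go
      where
      affine : ∀ a b → Rational (λ u → a + u * (b - a))
      affine a b = +-rational (constant-rational a) (*-rational id-rational (constant-rational (b - a)))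
      go : ∀ f → Rational (λ u → f at segment p q u)
      go (con a) = constant-rational a
      go (var (xᵥ i j)) = xCoord-rational (affine _ _) (affine _ _) (constrained (i , j))
      go (var (yᵥ i j)) = yCoord-rational (affine _ _) (affine _ _) (constrained (i , j))
      go (f :+ g) = +-rational (go f) (go g)
      go (f :* g) = *-rational (go f) (go g)
      go (:- f) = -‿rational (go f)

    at-cong : ∀ {p q} → (∀ κ → proj₁ (p κ) ≈ proj₁ (q κ) × proj₂ (p κ) ≈ proj₂ (q κ)) → ∀ f → f at p ≈ f at q
    at-cong p≈q = eval-cong λ
      { (xᵥ i j) → xCoord-cong (constrained (i , j)) (proj₁ (p≈q (i , j))) (proj₂ (p≈q (i , j)))
      ; (yᵥ i j) → yCoord-cong (constrained (i , j)) (proj₁ (p≈q (i , j))) (proj₂ (p≈q (i , j))) }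

    at-segment-0 : ∀ p q f → f at segment p q 0# ≈ f at p
    at-segment-0 p q = at-cong λ κ → initial _ _ , initial _ _
      where
      initial : ∀ a b → a + 0# * (b - a) ≈ a
      initial = solve 2 (λ a b → a ⊕ numeral 0 ⊗ (b ⊖ a) := a) refl

    at-segment-1 : ∀ p q f → f at segment p q 1# ≈ f at q
    at-segment-1 p q = at-cong λ κ → final _ _ , final _ _
      where
      final : ∀ a b → a + 1# * (b - a) ≈ b
      final = solve 2 (λ a b → a ⊕ numeral 1 ⊗ (b ⊖ a) := b) refl

    common-nonvanishing : ∀ {f g p q} → f at p ≉ 0# → g at q ≉ 0# → ∃[ o ] (f at o) * (g at o) ≉ 0#
    common-nonvanishing {f} {g} {p} {q} fp≉0 gq≉0 =
      segment p q (proj₁ nonzero) , *-≉0 (proj₁ (proj₂ nonzero)) (proj₂ (proj₂ nonzero))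
      where
      nonzero = common-nonzero (segment-rational p q f) (segment-rational p q g)
        (λ eq → fp≉0 (trans (sym (at-segment-0 p q f)) eq))
        (λ eq → gq≉0 (trans (sym (at-segment-1 p q g)) eq))

    -- The two assumptions pull in opposite directions: one makes `I` large enough to reduce `y²`,
    -- the other small enough for evaluation to descend to the quotient.
    module _ (I : Ideal (ℝ[x,y] ℝ n) (c ⊔ ℓ₁))
      (circle∈I : ∀ {κ} → constrained κ ≡ true → circle κ ∈ ⟦ I ⟧)
      (I-vanishes : ∀ {f} → f ∈ ⟦ I ⟧ → ∀ p → f at p ≈ 0#)
      where

      private
        C = ℝ[x,y] ℝ n / I
        module C = CommutativeRing C
      open QuotientRing (ℝ[x,y] ℝ n) I
      open RingExtensions C

      at-isHomomorphism : ∀ p → IsRingHomomorphism C.rawRing rawRing (_at p)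
      at-isHomomorphism p = record
        { isSemiringHomomorphism = record
          { isNearSemiringHomomorphism = record
            { +-isMonoidHomomorphism = record
              { isMagmaHomomorphism = record
                { isRelHomomorphism = record { cong = λ f≈g → minus≈0⇒≈ (I-vanishes f≈g p) }
                ; homo = λ _ _ → refl
                }
              ; ε-homo = refl
              }
            ; *-homo = λ _ _ → refl
            }
          ; 1#-homo = refl
          }
        ; -‿homo = λ _ → refl
        }

      open Nonvanishing ℝ C (λ p f → f at p) at-isHomomorphism

      -- Constants are included because they supply the values `α k` in divisions and the `r` in
      -- `y² = r - x²`.
      record Subring : Set (Level.suc (c ⊔ ℓ₁)) where
        field
          member : Pred Polynomial (c ⊔ ℓ₁)
          isSubring : IsSubring member
          con∈ : ∀ a → member (con a)

      open Subring

      constants : Subring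
      constants = record
        { member = λ f → ∃[ a ] f C.≈ con a
        ; isSubring = record
          { respects = λ { f≈g (a , f≈a) → a , C.trans (C.sym f≈g) f≈a }
          ; 1-closed = 1# , C.refl
          ; +-closed = λ { (a , f≈a) (b , g≈b) → a + b , C.trans (C.+-cong f≈a g≈b) (C.sym (≈⇒≈/I (con-+ a b))) }
          ; *-closed = λ { (a , f≈a) (b , g≈b) → a * b , C.trans (C.*-cong f≈a g≈b) (C.sym (≈⇒≈/I (con-* a b))) }
          ; -‿closed = λ { (a , f≈a) → - a , C.trans (C.-‿cong f≈a) (C.sym (≈⇒≈/I (con-neg a))) }
          }
        ; con∈ = λ a → a , C.refl
        }
        where
        con-neg : ∀ a → con (- a) P.≈ P.- con a
        con-neg a = GroupProperties.inverseʳ-unique P.+-group (con a) (con (- a))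
          (P.trans (P.sym (con-+ a (- a))) (con-cong (-‿inverseʳ a)))

      adjoin : Polynomial → Subring → Subring
      adjoin z S = record
        { member = Adjoin (isSubring S) z
        ; isSubring = adjoin-isSubring (isSubring S)
        ; con∈ = λ a → scalar∈Adjoin (isSubring S) (con∈ S a)
        }

      y²∈ : ∀ S {κ} → constrained κ ≡ true → member (adjoin (x κ) S) (y κ C.* y κ)
      y²∈ S {κ} eq = sum-of-squares-closed (isSubring (adjoin (x κ) S)) {x κ} {y κ} {con r}
        (variable∈Adjoin (isSubring S)) (con∈ (adjoin (x κ) S) r) (∈⇒≈0 (circle∈I eq))

      -- A free pair contributes two polynomial variables, a constrained one a variable and then a
      -- square root. The mask value is a separate argument, so that later lemmas can match on it.
      extend : ∀ κ b → constrained κ ≡ b → Subring → Subring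
      extend κ false _ S = adjoin (y κ) (adjoin (x κ) S)
      extend κ true eq S = record
        { member = AdjoinSqrt (isSubring S₁) (y κ)
        ; isSubring = adjoinSqrt-isSubring (isSubring S₁) (y²∈ S eq)
        ; con∈ = λ a → scalar∈AdjoinSqrt (isSubring S₁) (con∈ S₁ a)
        }
        where
        S₁ = adjoin (x κ) S

      -- Modulo I, the polynomials in the variables of the listed pairs.
      tower : List Pair → Subring
      tower [] = constants
      tower (κ ∷ L) = extend κ (constrained κ) ≡.refl (tower L)

      extend-⊇ : ∀ {κ} b (eq : constrained κ ≡ b) S → member S ⊆ member (extend κ b eq S)
      extend-⊇ false eq S f∈ = scalar∈Adjoin (isSubring (adjoin _ S)) (scalar∈Adjoin (isSubring S) f∈)
      extend-⊇ true eq S f∈ = scalar∈AdjoinSqrt (isSubring (adjoin _ S)) (scalar∈Adjoin (isSubring S) f∈)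

      x∈extend : ∀ {κ} b (eq : constrained κ ≡ b) S → member (extend κ b eq S) (x κ)
      x∈extend false eq S = scalar∈Adjoin (isSubring (adjoin _ S)) (variable∈Adjoin (isSubring S))
      x∈extend true eq S = scalar∈AdjoinSqrt (isSubring (adjoin _ S)) (variable∈Adjoin (isSubring S))

      y∈extend : ∀ {κ} b (eq : constrained κ ≡ b) S → member (extend κ b eq S) (y κ)
      y∈extend false eq S = variable∈Adjoin (isSubring (adjoin _ S))
      y∈extend true eq S = variable∈AdjoinSqrt (isSubring (adjoin _ S))

      variables∈tower : ∀ {κ L} → κ List.∈ L → member (tower L) (x κ) × member (tower L) (y κ)
      variables∈tower {κ} {_ ∷ L} (here ≡.refl) =
        x∈extend (constrained κ) ≡.refl (tower L) , y∈extend (constrained κ) ≡.refl (tower L)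
      variables∈tower {L = κ ∷ L} (there κ∈) =
        extend-⊇ (constrained κ) ≡.refl (tower L) (proj₁ (variables∈tower κ∈)) ,
        extend-⊇ (constrained κ) ≡.refl (tower L) (proj₂ (variables∈tower κ∈))

      tower-exhaustive : ∀ {L} → (∀ κ → κ List.∈ L) → ∀ f → member (tower L) f
      tower-exhaustive {L} L-full = go
        where
        open IsSubring (isSubring (tower L))
        go : ∀ f → member (tower L) f
        go (con a) = con∈ (tower L) a
        go (var (xᵥ i j)) = proj₁ (variables∈tower (L-full (i , j)))
        go (var (yᵥ i j)) = proj₂ (variables∈tower (L-full (i , j)))
        go (f :+ g) = +-closed (go f) (go g)
        go (f :* g) = *-closed (go f) (go g)
        go (:- f) = -‿closed (go f)

      extend-least : ∀ {κ} b (eq : constrained κ ≡ b) S {ℓ} {T : Pred Polynomial ℓ} → IsSubring T →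
                     member S ⊆ T → T (x κ) → T (y κ) → member (extend κ b eq S) ⊆ T
      extend-least false eq S T-subring S⊆T x∈ y∈ =
        adjoin-least (isSubring (adjoin _ S)) T-subring (adjoin-least (isSubring S) T-subring S⊆T x∈) y∈
      extend-least true eq S T-subring S⊆T x∈ y∈ =
        adjoinSqrt-least (isSubring (adjoin _ S)) T-subring (adjoin-least (isSubring S) T-subring S⊆T x∈) y∈

      tower-agree : ∀ {p q} L → (∀ {κ} → κ List.∈ L → p κ ≡ q κ) → member (tower L) ⊆ Agree p q
      tower-agree {p} {q} [] _ (a , f≈a) = IsSubring.respects (agree-isSubring {p} {q}) (C.sym f≈a) refl
      tower-agree {p} {q} (κ ∷ L) p≡q = extend-least (constrained κ) ≡.refl (tower L) (agree-isSubring {p} {q})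
        (tower-agree L (p≡q ∘ there))
        (reflexive (≡.cong (xCoord (constrained κ)) (p≡q (here ≡.refl))))
        (reflexive (≡.cong (yCoord (constrained κ)) (p≡q (here ≡.refl))))

      -- The freedom to move a pair not yet adjoined without disturbing values already found; it
      -- holds because the list of pairs has no repetitions.
      Ignores : Subring → Pair → Set (c ⊔ ℓ₁)
      Ignores S κ = ∀ p v → member S ⊆ Agree (p [ κ ↦ v ]) p

      tower-ignores : ∀ {κ L} → All (κ ≢_) L → Ignores (tower L) κ
      tower-ignores {κ} {L} κ∉L p v = tower-agree L λ κ′∈ → update-other p v (All.lookup κ∉L κ′∈)

      x-at : ∀ {κ b} → constrained κ ≡ b → ∀ p v → x κ at p [ κ ↦ v ] ≈ xCoord b v
      x-at {κ} eq p v = reflexive (≡.cong₂ xCoord eq (update-same p κ v))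

      y-at : ∀ {κ b} → constrained κ ≡ b → ∀ p v → y κ at p [ κ ↦ v ] ≈ yCoord b v
      y-at {κ} eq p v = reflexive (≡.cong₂ yCoord eq (update-same p κ v))

      constants-at : ∀ S (α : ℕ → Carrier) k → ∃[ d ] member S d × ∀ p → d at p ≈ α k
      constants-at S α k = con (α k) , con∈ S (α k) , λ _ → refl

      -- For a free pair, `x` and then `y` are set to natural numbers. For a constrained pair, `x`
      -- runs through the abscissas of positive parameters, and the opposite parameter gives the
      -- mirror point that `sqrt-decide` asks for.
      extend-decidable : ∀ {κ} b (eq : constrained κ ≡ b) S → Ignores S κ →
                         Decidable (member S) → Decidable (member (extend κ b eq S))
      extend-decidable {κ} false eq S ignores dec (_ , f∈) =
        forget (horner-decide (isSubring S₁) dec₁ fromℕ-injective (constants-at S₁ (fromℕ ℝ)) set-y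
          (λ k p → y-at eq p _) S₁-agree f∈)
        where
        S₁ = adjoin (x κ) S
        set-x set-y : ℕ → Point → Point
        set-x k p = p [ κ ↦ (fromℕ ℝ k , 0#) ]
        -- The first coordinate is kept, because `x κ` already belongs to `S₁`.
        set-y k p = p [ κ ↦ (proj₁ (p κ) , fromℕ ℝ k) ]
        forget : ∀ {f} {σ : ℕ → Point → Point} → f C.≈ C.0# ⊎ (∃[ k ] ∃[ p ] f at σ k p ≉ 0#) →
                 f C.≈ C.0# ⊎ ∃[ p ] f at p ≉ 0#
        forget (inj₁ f≈0) = inj₁ f≈0
        forget (inj₂ (k , p , f≉0)) = inj₂ (_ , f≉0)
        dec₁ : Decidable (member S₁)
        dec₁ (_ , f∈) = forget (horner-decide (isSubring S) dec fromℕ-injective (constants-at S (fromℕ ℝ)) set-x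
          (λ k p → x-at eq p _) (λ k p → ignores p _) f∈)
        S₁-agree : ∀ k p → member S₁ ⊆ Agree (set-y k p) p
        S₁-agree k p = adjoin-least (isSubring S) (agree-isSubring {set-y k p} {p}) (ignores p _)
          (trans (x-at eq p _) (reflexive (≡.cong (λ b → xCoord b (p κ)) (≡.sym eq))))
      extend-decidable {κ} true eq S ignores dec = sqrt-decide (isSubring S₁) λ { (_ , f∈) →
          opposite (horner-decide (isSubring S) dec (positive-xc-injective s≉0) (constants-at S _) (λ k p → set p (parameter k))
            (λ k p → x-at eq p _) (λ k p → ignores p _) f∈) }
        where
        S₁ = adjoin (x κ) S
        -- Counting starts at 1, since `y` vanishes at parameter 0.
        parameter : ℕ → Carrier
        parameter k = fromℕ ℝ (ℕ.suc k)
        set : Point → Carrier → Point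
        set p t = p [ κ ↦ (t , 0#) ]
        S₁-agree : ∀ p t → member S₁ ⊆ Agree (set p t) (set p (- t))
        S₁-agree p t = adjoin-least (isSubring S) (agree-isSubring {set p t} {set p (- t)})
          (λ f∈ → trans (ignores p _ f∈) (sym (ignores p _ f∈)))
          (trans (x-at eq p _) (trans (sym (xc-even t)) (sym (x-at eq p _))))
        opposite : ∀ {f} → f C.≈ C.0# ⊎ (∃[ k ] ∃[ p ] f at set p (parameter k) ≉ 0#) →
                   f C.≈ C.0# ⊎ ∃[ p ] f at p ≉ 0# × y κ at p ≉ 0# ×
                     ∃[ p′ ] member S₁ ⊆ Agree p p′ × y κ at p′ ≈ - (y κ at p)
        opposite (inj₁ f≈0) = inj₁ f≈0
        opposite (inj₂ (k , p , f≉0)) = inj₂ (set p (parameter k) , f≉0 ,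
          (λ eq′ → yc-≉0 s≉0 (fromℕ-suc≉0 k) (trans (sym (y-at eq p _)) eq′)) ,
          set p (- parameter k) , S₁-agree p (parameter k) ,
          trans (y-at eq p _) (trans (yc-odd (parameter k)) (-‿cong (sym (y-at eq p _)))))

      tower-decidable : ∀ {L} → Unique L → Decidable (member (tower L))
      tower-decidable {[]} _ (a , f≈a) with a ≟ 0#
      ... | yes a≈0 = inj₁ (C.trans f≈a (≈⇒≈/I (con-cong a≈0)))
      ... | no a≉0 = inj₂ (origin , λ f≈0 → a≉0 (trans (sym (minus≈0⇒≈ (I-vanishes f≈a origin))) f≈0))
      tower-decidable {κ ∷ L} (κ∉L ∷ unique) =
        extend-decidable (constrained κ) ≡.refl (tower L) (tower-ignores κ∉L) (tower-decidable unique)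

      -- With `I-vanishes`, this identifies `I` as the ideal of all polynomials vanishing at every
      -- parameter point.
      member-or-nonvanishing : ∀ f → f ∈ ⟦ I ⟧ ⊎ ∃[ p ] f at p ≉ 0#
      member-or-nonvanishing f with tower-decidable pairs-unique (tower-exhaustive pairs-full f)
        where
        pairs-unique = cartesianProduct⁺ (allFin⁺ n) (allFin⁺ n)
        pairs-full : ∀ κ → κ List.∈ cartesianProduct (allFin n) (allFin n)
        pairs-full (i , j) = ∈-cartesianProduct⁺ (∈-allFin i) (∈-allFin j)
      ... | inj₁ f≈0 = inj₁ (≈0⇒∈ f≈0)
      ... | inj₂ nonvanishing = inj₂ nonvanishing

      1∉I : P.1# ∉ ⟦ I ⟧
      1∉I 1∈ = 0≉1 (sym (I-vanishes 1∈ origin))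

      isPrime : IsPrime (ℝ[x,y] ℝ n) I
      isPrime = 1∉I , λ f g fg∈ → decide fg∈ (member-or-nonvanishing f) (member-or-nonvanishing g)
        where
        decide : ∀ {f g} → f P.* g ∈ ⟦ I ⟧ → f ∈ ⟦ I ⟧ ⊎ (∃[ p ] f at p ≉ 0#) →
                 g ∈ ⟦ I ⟧ ⊎ (∃[ p ] g at p ≉ 0#) → f ∈ ⟦ I ⟧ ⊎ g ∈ ⟦ I ⟧
        decide fg∈ (inj₁ f∈) _ = inj₁ f∈
        decide fg∈ (inj₂ _) (inj₁ g∈) = inj₂ g∈
        decide {f} {g} fg∈ (inj₂ (p , f≉0)) (inj₂ (q , g≉0)) =
          contradiction (I-vanishes fg∈ (proj₁ o)) (proj₂ o)
          where
          o = common-nonvanishing {f} {g} {p} {q} f≉0 g≉0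

-- Generated ideals, and sums with a single nonzero term

module IdealGeneration {c ℓ} (R : CommutativeRing c ℓ) where
  open CommutativeRing R

  generated-least : ∀ {p q} {S : Pred Carrier p} (I : Ideal R q) → S ⊆ ⟦ I ⟧ → Generated R S ⊆ ⟦ I ⟧
  generated-least I S⊆I (gen a∈) = S⊆I a∈
  generated-least I S⊆I (resp a≈b a∈) = Ideal.respects I a≈b (generated-least I S⊆I a∈)
  generated-least I S⊆I 0∈ = Ideal.0-closed I
  generated-least I S⊆I (+∈ a∈ b∈) = Ideal.+-closed I (generated-least I S⊆I a∈) (generated-least I S⊆I b∈)
  generated-least I S⊆I (*∈ d a∈) = Ideal.*-closed I d (generated-least I S⊆I a∈)

  open Sum +-commutativeMonoid using (sum; sum-cong-≋; sum-replicate-zero)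

  sum-single : ∀ {n} (t : Vector Carrier n) i → (∀ j → j ≢ i → t j ≈ 0#) → sum t ≈ t i
  sum-single {suc n} t Fin.zero t≈0 = trans
    (+-congˡ (trans (sum-cong-≋ (λ j → t≈0 (Fin.suc j) λ ())) (sum-replicate-zero n))) (+-identityʳ _)
  sum-single {suc n} t (Fin.suc i) t≈0 = trans
    (+-cong (t≈0 Fin.zero λ ()) (sum-single (t ∘ Fin.suc) i λ j j≢i → t≈0 (Fin.suc j) (j≢i ∘ Fin.suc-injective)))
    (+-identityˡ _)

-- The generators for the standard basis and their regularity

module StandardBasis {c ℓ₁ ℓ₂} (ℝ : CompleteOrderedField c ℓ₁ ℓ₂) {n : ℕ}
  (A : Matrix ℝ n) (A≈I : _≈ᴹ_ ℝ A (Iₙ ℝ)) where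
  open PolynomialRing (CompleteOrderedField.commutativeRing ℝ) (Var n) using (Polynomial; con; var; con-cong)
  private
    module ℝ = CompleteOrderedField ℝ
    module P = CommutativeRing (ℝ[x,y] ℝ n)
  open IdealGeneration (ℝ[x,y] ℝ n)
  open RingProperties P.ring using (-0#≈0#)
  open import Relation.Binary.Reasoning.Setoid P.setoid

  diagonal : ∀ q → con (proj₁ (A q q)) P.≈ P.1# × con (proj₂ (A q q)) P.≈ P.0#
  diagonal q with q Fin.≟ q | A≈I q q
  ... | yes _ | re≈1 , im≈0 = con-cong re≈1 , con-cong im≈0
  ... | no q≢q | _ = contradiction ≡.refl q≢q

  off-diagonal : ∀ {i q} → i ≢ q → con (proj₁ (A i q)) P.≈ P.0# × con (proj₂ (A i q)) P.≈ P.0#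
  off-diagonal {i} {q} i≢q with i Fin.≟ q | A≈I i q
  ... | yes i≡q | _ = contradiction i≡q i≢q
  ... | no _ | re≈0 , im≈0 = con-cong re≈0 , con-cong im≈0

  -- Only the term `i = q` survives in either sum, so the indices swap: generator `(j , q)` is the
  -- circle of the pair `(q , j)`.
  generator≈circle : ∀ j q → generator ℝ A j q P.≈
    (var (xᵥ q j) P.* var (xᵥ q j) P.+ var (yᵥ q j) P.* var (yᵥ q j)) P.- con (fromℕ ℝ n ℝ.⁻¹)
  generator≈circle j q = P.+-congʳ (P.+-cong (P.*-cong u≈ u≈) (P.*-cong v≈ v≈))
    where
    u≈ = P.trans (sum-single _ q (λ i i≢q → begin
        _ P.* con (proj₁ (A i q)) P.+ _ P.* con (proj₂ (A i q))
          ≈⟨ P.+-cong (P.*-congˡ (proj₁ (off-diagonal i≢q))) (P.*-congˡ (proj₂ (off-diagonal i≢q))) ⟩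
        var (xᵥ i j) P.* P.0# P.+ var (yᵥ i j) P.* P.0#
          ≈⟨ P.+-cong (P.zeroʳ _) (P.zeroʳ _) ⟩
        P.0# P.+ P.0#
          ≈⟨ P.+-identityˡ _ ⟩
        P.0# ∎))
      (begin
        var (xᵥ q j) P.* con (proj₁ (A q q)) P.+ var (yᵥ q j) P.* con (proj₂ (A q q))
          ≈⟨ P.+-cong (P.*-congˡ (proj₁ (diagonal q))) (P.*-congˡ (proj₂ (diagonal q))) ⟩
        var (xᵥ q j) P.* P.1# P.+ var (yᵥ q j) P.* P.0#
          ≈⟨ P.+-cong (P.*-identityʳ _) (P.zeroʳ _) ⟩
        var (xᵥ q j) P.+ P.0#
          ≈⟨ P.+-identityʳ _ ⟩
        var (xᵥ q j) ∎)
    v≈ = P.trans (sum-single _ q (λ i i≢q → begin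
        con (proj₁ (A i q)) P.* _ P.- _ P.* con (proj₂ (A i q))
          ≈⟨ P.+-cong (P.*-congʳ (proj₁ (off-diagonal i≢q))) (P.-‿cong (P.*-congˡ (proj₂ (off-diagonal i≢q)))) ⟩
        P.0# P.* var (yᵥ i j) P.- var (xᵥ i j) P.* P.0#
          ≈⟨ P.+-cong (P.zeroˡ _) (P.trans (P.-‿cong (P.zeroʳ _)) -0#≈0#) ⟩
        P.0# P.+ P.0#
          ≈⟨ P.+-identityˡ _ ⟩
        P.0# ∎))
      (begin
        con (proj₁ (A q q)) P.* var (yᵥ q j) P.- var (xᵥ q j) P.* con (proj₂ (A q q))
          ≈⟨ P.+-cong (P.*-congʳ (proj₁ (diagonal q))) (P.-‿cong (P.*-congˡ (proj₂ (diagonal q)))) ⟩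
        P.1# P.* var (yᵥ q j) P.- var (xᵥ q j) P.* P.0#
          ≈⟨ P.+-cong (P.*-identityˡ _) (P.trans (P.-‿cong (P.zeroʳ _)) -0#≈0#) ⟩
        var (yᵥ q j) P.+ P.0#
          ≈⟨ P.+-identityʳ _ ⟩
        var (yᵥ q j) ∎)

  module _ {s : ℝ.Carrier} (s²≈r : s ℝ.* s ℝ.≈ fromℕ ℝ n ℝ.⁻¹) (s≉0 : s ℝ.≉ ℝ.0#) where
    open CircleIdeals ℝ s²≈r s≉0 n

    -- Packaged as an ideal, so that vanishing on generators passes to everything they generate.
    vanishing : (Pair → Bool) → Point → Ideal (ℝ[x,y] ℝ n) ℓ₁
    vanishing b p = record
      { ⟦_⟧ = λ f → at′ f ℝ.≈ ℝ.0#
      ; respects = λ f≈g f≈0 → ℝ.trans (ℝ.sym (eval-≋ (coordinate b p) f≈g)) f≈0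
      ; 0-closed = ℝ.refl
      ; +-closed = λ f≈0 g≈0 → ℝ.trans (ℝ.+-cong f≈0 g≈0) (ℝ.+-identityˡ _)
      ; *-closed = λ g f≈0 → ℝ.trans (ℝ.*-congˡ f≈0) (ℝ.zeroʳ _)
      }
      where
      open Evaluation ℝ.commutativeRing (Var n) using (eval-≋)
      at′ : Polynomial → ℝ.Carrier
      at′ f = _at_ b f p

    generator-vanishes : ∀ b p j q → b (q , j) ≡ true → generator ℝ A j q ∈ ⟦ vanishing b p ⟧
    generator-vanishes b p j q eq =
      Ideal.respects (vanishing b p) (P.sym (generator≈circle j q)) (circle-at b {q , j} eq p)

    J-isPrime : IsPrime (ℝ[x,y] ℝ n) (J ℝ A)
    J-isPrime = isPrime (const true) (J ℝ A)
      (λ { {q , j} _ → gen (j , q , P.sym (generator≈circle j q)) })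
      (λ f∈ p → generated-least (vanishing (const true) p)
        (λ { (j , q , f≈) → Ideal.respects (vanishing (const true) p) (P.sym f≈)
               (generator-vanishes (const true) p j q ≡.refl) }) f∈)

    generators : Vector Polynomial (n ℕ.* n)
    generators k = generator ℝ A (proj₁ (remQuot {n} n k)) (proj₂ (remQuot {n} n k))

    generators-combine : ∀ j q → generators (combine j q) ≡ generator ℝ A j q
    generators-combine j q = ≡.cong (λ jq → generator ℝ A (proj₁ jq) (proj₂ jq)) (Fin.remQuot-combine j q)

    J≐⟨generators⟩ : ⟦ J ℝ A ⟧ ≐ ⟦ ⟨_⟩ (ℝ[x,y] ℝ n) (Entries (ℝ[x,y] ℝ n) generators) ⟧
    J≐⟨generators⟩ =
      generated-least (⟨_⟩ (ℝ[x,y] ℝ n) (Entries (ℝ[x,y] ℝ n) generators))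
        (λ { (j , q , f≈) → gen (combine j q , P.trans f≈ (P.reflexive (≡.sym (generators-combine j q)))) }) ,
      generated-least (J ℝ A) (λ { (k , f≈) → gen (_ , _ , f≈) })

    module _ (k : Fin (n ℕ.* n)) where
      private
        I = ⟨_⟩ (ℝ[x,y] ℝ n) (EntriesBefore (ℝ[x,y] ℝ n) generators k)
      open QuotientRing (ℝ[x,y] ℝ n) I

      -- The mask of the generators preceding position `k`, with the index swap of
      -- `generator≈circle`.
      before : Pair → Bool
      before (q , j) = isYes (combine j q Fin.<? k)

      before-index : ∀ l → before (proj₂ (remQuot {n} n l) , proj₁ (remQuot {n} n l)) ≡ isYes (l Fin.<? k)
      before-index l = ≡.cong (λ i → isYes (i Fin.<? k)) (Fin.combine-remQuot {n} n l)

      I-vanishes : ∀ {f} → f ∈ ⟦ I ⟧ → ∀ p → f ∈ ⟦ vanishing before p ⟧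
      I-vanishes f∈ p = generated-least (vanishing before p)
        (λ { (l , l<k , f≈) → Ideal.respects (vanishing before p) (P.sym f≈)
          (generator-vanishes before p _ _ (≡.trans (before-index l) (isYes-true l l<k))) }) f∈
        where
        isYes-true : ∀ l → l Fin.< k → isYes (l Fin.<? k) ≡ true
        isYes-true l l<k with l Fin.<? k
        ... | yes _ = ≡.refl
        ... | no l≮k = contradiction l<k l≮k

      I-isPrime : IsPrime (ℝ[x,y] ℝ n) I
      I-isPrime = isPrime before I circle∈I I-vanishes
        where
        circle∈I : ∀ {κ} → before κ ≡ true → circle κ ∈ ⟦ I ⟧
        circle∈I {q , j} eq with combine j q Fin.<? k
        ... | yes lt = gen (combine j q , lt , P.trans (P.sym (generator≈circle j q))
                              (P.reflexive (≡.sym (generators-combine j q))))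

      -- The comparison in the mask is strict, so the circle of position `k` itself is still free.
      generator∉I : generators k ∉ ⟦ I ⟧
      generator∉I g∈ = circle-at-origin before (≡.trans (before-index k) (isYes-false k (Fin.<-irrefl ≡.refl)))
        (Ideal.respects (vanishing before origin) (generator≈circle _ _) (I-vanishes g∈ origin))
        where
        isYes-false : ∀ l → ¬ l Fin.< k → isYes (l Fin.<? k) ≡ false
        isYes-false l l≮k with l Fin.<? k
        ... | yes l<k = contradiction l<k l≮k
        ... | no _ = ≡.refl

      generator-nonZeroDivisor : NonZeroDivisor (ℝ[x,y] ℝ n / I) (generators k)
      generator-nonZeroDivisor f gf≈0 with proj₂ I-isPrime (generators k) f (≈0⇒∈ gf≈0)
      ... | inj₁ g∈ = contradiction g∈ generator∉I
      ... | inj₂ f∈ = ∈⇒≈0 f∈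

    J-isCompleteIntersection : IsCompleteIntersection (ℝ[x,y] ℝ n) (J ℝ A)
    J-isCompleteIntersection = n ℕ.* n , generators , (generator-nonZeroDivisor , nontrivial) , J≐⟨generators⟩
      where
      nontrivial : Nontrivial (ℝ[x,y] ℝ n / ⟨_⟩ (ℝ[x,y] ℝ n) (Entries (ℝ[x,y] ℝ n) generators))
      nontrivial 1≈0 = proj₁ J-isPrime (proj₂ J≐⟨generators⟩
        (QuotientRing.≈0⇒∈ (ℝ[x,y] ℝ n) (⟨_⟩ (ℝ[x,y] ℝ n) (Entries (ℝ[x,y] ℝ n) generators)) 1≈0))

open import Data.Nat.Base using (_≤_; _∸_)

theorem4 : ∀ {c ℓ₁ ℓ₂} (ℝ : CompleteOrderedField c ℓ₁ ℓ₂) →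
    ∀ (n m : ℕ) → 1 ≤ n → (2≤m : 2 ≤ m) →
    (A : Fin (m ∸ 1) → Matrix ℝ n) →
    IsMUBSystem ℝ A →
    _≈ᴹ_ ℝ (A (first 2≤m)) (Iₙ ℝ) →
    IsCompleteIntersection (ℝ[x,y] ℝ n) (J ℝ (A (first 2≤m))) ×
    IsPrime (ℝ[x,y] ℝ n) (J ℝ (A (first 2≤m)))
theorem4 ℝ (suc k) m _ 2≤m A _ A₁≈I = J-isCompleteIntersection s²≈r s≉0 , J-isPrime s²≈r s≉0
  where
  open CompleteOrderedField ℝ
  open OrderedField ℝ
  open StandardBasis ℝ (A (first 2≤m)) A₁≈I
  n≉0 : fromℕ ℝ (suc k) ≉ 0#
  n≉0 = fromℕ-suc≉0 k
  -- The common radius of all the circles, up to sign.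
  root : ∃[ s ] s * s ≈ fromℕ ℝ (suc k) ⁻¹
  root = sqrt-exists (⁻¹-nonNeg (fromℕ-nonNeg (suc k)) n≉0) (⁻¹-≉0 n≉0)
  s²≈r = proj₂ root
  s≉0 : proj₁ root ≉ 0#
  s≉0 s≈0 = ⁻¹-≉0 n≉0 (trans (sym s²≈r) (trans (*-congʳ s≈0) (zeroˡ _)))
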